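{- Let $\bar n\in\mathbf{N}$ and let ${\bold H}$ be a function with domain $\omega$ whose values ${\bold H}(i)$ are countable sets with at least two elements. Then: (1) the forcing notion $\mathbb{Q}^{\bold H}_{\bar n}$ is $\sigma$-$*$--linked; (2) conditions $p_0,p_1\in\mathbb{Q}^{\bold H}_{\bar n}$ are compatible in $\mathbb{Q}^{\bold H}_{\bar n}$ if and only if $\mathrm{POS}(p_0)\cap\mathrm{POS}(p_1)\neq\emptyset$; (3) $\mathbb{Q}^{\bold H}_{\bar n}$ is a Souslin ccc forcing notion.
   Context: $\mathbf{N}$ is the set of sequences $\bar n=\langle n^0_m,n^1_m:m<\omega\rangle$ of integers with $4<n^0_m\leq n^1_m<n^0_{m+1}$ for all $m$, $2^{2(m^*+2)}\sum_{m<m^*}n^0_m n^1_m<n^0_{m^*}$ for every $m^*\in\omega$, and $\lim_{m\to\infty}(n^1_m)^{1/(2n^0_m)}=\infty$. Conditions of $\mathbb{Q}^{\bold H}_{\bar n}$ are sequences $p=(w^p,\sigma^p_0,\sigma^p_1,\dots)$ of finite functions with pairwise disjoint domains, $w^p(i),\sigma^p_j(i)\in{\bold H}(i)$, such that for some $m^*=m^*(p)<\omega$ there is a partition $\langle V^p_m:m^*\leq m<\omega\rangle$ of $\omega$ with $|V^p_m|\leq n^1_m2^{m^*}$ and $|\mathrm{dom}(\sigma^p_j)|\geq n^0_m/2^{m^*}$ for $j\in V^p_m$. $\mathrm{POS}(p)=\{\eta\in\prod_{i\in\omega}{\bold H}(i): w^p\subseteq\eta,\ \sigma^p_j\not\subseteq\eta\text{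 for all }j\}$, and $p\leq q$ ($q$ stronger) iff $\mathrm{POS}(q)\subseteq\mathrm{POS}(p)$. A forcing notion $\mathbb{Q}$ is $\sigma$-$*$--linked if for every $n\in\omega$ there is a partition $\langle A_i:i\in\omega\rangle$ of $\mathbb{Q}$ such that any $q_0,\dots,q_n$ in one $A_i$ have a common upper bound. Conditions are regarded as points of the Polish space of all sequences $(w,\sigma_0,\sigma_1,\dots)$ of finite functions with $w(i),\sigma_j(i)\in{\bold H}(i)$ (product of discrete spaces); a forcing notion is Souslin if the set of conditions, the order relation and the incompatibility relation are $\Sigma^1_1$ subsets of this space and of its square, and Souslin ccc if additionally it satisfies the countable chain condition. -}

module Defs where

open import Level using (0ℓ)
open import Data.Nat.Base using (ℕ; zero; suc; _+_; _*_; _^_; _≤_; _<_)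
open import Data.Nat.Properties using (≤-refl)
open import Data.Fin.Base using (Fin)
open import Data.List.Base using (List; length; map; sum; upTo)
open import Data.List.Membership.Propositional using (_∈_)
open import Data.List.Relation.Binary.Disjoint.Propositional using (Disjoint)
open import Data.List.Relation.Unary.All using (All)
open import Data.List.Relation.Unary.Linked using (Linked)
open import Data.List.Relation.Unary.Unique.Propositional using (Unique)
open import Data.Product.Base using (Σ; ∃; ∃₂; _×_; _,_; proj₁; proj₂)
open import Function.Base using (_on_)
open import Function.Bundles using (_⇔_)
open import Relation.Binary.Core using (Rel)
open import Relation.Binary.Definitions using (_Respects_)
open import Relation.Binary.PropositionalEquality
  using (_≡_; _≢_; refl; sym; trans; cong; subst)
open import Relation.Binary.Structures using (IsPreorder)
open import Relation.Nullary.Negation.Core using (¬_)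
open import Relation.Unary using (Pred; _⊆_)

-- A topological space in which the sets { y ∣ Agree n x y }, n : ℕ, form a
-- neighbourhood base at x.  Elements are compared by _≈_, not by _≡_, since
-- sequences are functions and function extensionality is not available.

record Space : Set₁ where
  field
    Carrier : Set
    Agree   : ℕ → Rel Carrier 0ℓ

  infix 4 _≈_
  _≈_ : Rel Carrier 0ℓ
  x ≈ y = ∀ n → Agree n x y

-- The product of ω copies of the discrete space D.

Seq : Set → Space
Seq D = record
  { Carrier = ℕ → D
  ; Agree   = λ n x y → ∀ i → i < n → x i ≡ y i
  }

Baire : Space
Baire = Seq ℕ

infixr 2 _×ˢ_
_×ˢ_ : Space → Space → Space
S ×ˢ T = record
  { Carrier = S.Carrier × T.Carrier
  ; Agree   = λ n x y → S.Agree n (proj₁ x) (proj₁ y) × T.Agree n (proj₂ x) (proj₂ y)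
  }
  where
  module S = Space S
  module T = Space T

-- C contains every point of its closure.

Closed : (S : Space) → Pred (Space.Carrier S) 0ℓ → Set
Closed S C = ∀ x → (∀ n → ∃ λ y → C y × Agree n x y) → C x
  where open Space S

-- Boldface Σ¹₁: projections of closed subsets of S × ω^ω.

Σ¹₁ : (S : Space) → Pred (Space.Carrier S) 0ℓ → Set₁
Σ¹₁ S A = Σ (Pred (Space.Carrier (S ×ˢ Baire)) 0ℓ) λ C →
  Closed (S ×ˢ Baire) C × (∀ x → A x ⇔ (∃ λ f → C (x , f)))

-- Forcing notions whose conditions are points of S.  Larger conditions are
-- stronger.

record ForcingNotion (S : Space) : Set₁ where
  open Space S public

  infix 4 _≼_
  field
    Cond       : Pred Carrier 0ℓ
    Cond-resp  : Cond Respects _≈_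
    _≼_        : Rel Carrier 0ℓ
    isPreorder : IsPreorder _≈_ _≼_

  Compatible : Rel Carrier 0ℓ
  Compatible p q = ∃ λ r → Cond r × p ≼ r × q ≼ r

  -- Pieces of the partition may be empty.

  record IsPartition (A : ℕ → Pred Carrier 0ℓ) : Set where
    field
      resp     : ∀ i → A i Respects _≈_
      sound    : ∀ i → A i ⊆ Cond
      cover    : ∀ p → Cond p → ∃ λ i → A i p
      disjoint : ∀ i j p → A i p → A j p → i ≡ j

  σ-*-Linked : Set₁
  σ-*-Linked = ∀ (n : ℕ) → Σ (ℕ → Pred Carrier 0ℓ) λ A →
    IsPartition A ×
    (∀ i (q : Fin (suc n) → Carrier) → (∀ k → A i (q k)) →
      ∃ λ r → Cond r × (∀ k → q k ≼ r))

  IsAntichain : Pred Carrier 0ℓ → Set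
  IsAntichain A = A ⊆ Cond × (∀ p q → A p → A q → ¬ p ≈ q → ¬ Compatible p q)

  IsCountable : Pred Carrier 0ℓ → Set
  IsCountable A = Σ (ℕ → Carrier) λ e → ∀ p → A p → ∃ λ n → e n ≈ p

  CCC : Set₁
  CCC = ∀ A → IsAntichain A → IsCountable A

  record Souslin : Set₁ where
    field
      cond-Σ¹₁         : Σ¹₁ S Cond
      order-Σ¹₁        : Σ¹₁ (S ×ˢ S) λ (p , q) → Cond p × Cond q × p ≼ q
      incompatible-Σ¹₁ : Σ¹₁ (S ×ˢ S) λ (p , q) → Cond p × Cond q × ¬ Compatible p q

  SouslinCCC : Set₁
  SouslinCCC = Souslin × CCC

record 𝐍 (n⁰ n¹ : ℕ → ℕ) : Set where
  field
    4<n⁰   : ∀ m → 4 < n⁰ m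
    n⁰≤n¹  : ∀ m → n⁰ m ≤ n¹ m
    n¹<n⁰  : ∀ m → n¹ m < n⁰ (suc m)
    growth : ∀ m* → 2 ^ (2 * (m* + 2)) * sum (map (λ m → n⁰ m * n¹ m) (upTo m*)) < n⁰ m*
    -- lim (n¹ m)^(1/(2 n⁰ m)) = ∞, with K < x^(1/k) written as K^k < x
    limit  : ∀ K → ∃ λ M → ∀ m → M ≤ m → K ^ (2 * n⁰ m) < n¹ m

module _ (H : ℕ → Set) where

  -- Finite functions f with f(i) ∈ H(i), given by their graph listed in
  -- increasing order of arguments; the listing is canonical, so _≡_ is
  -- equality of functions and the length of the graph is |dom f|.

  record FinFun : Set where
    constructor _,_
    field
      graph      : List (Σ ℕ H)
      increasing : Linked (_<_ on proj₁) graph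

  open FinFun

  dom : FinFun → List ℕ
  dom f = map proj₁ (graph f)

  infix 4 _⊑_
  _⊑_ : FinFun → (∀ i → H i) → Set
  f ⊑ η = All (λ (i , a) → η i ≡ a) (graph f)

  -- A point p of this space is the sequence (w, σ₀, σ₁, …) with w = p 0 and
  -- σⱼ = p (suc j).

  𝕏 : Space
  𝕏 = Seq FinFun

  POS : (ℕ → FinFun) → Pred (∀ i → H i) 0ℓ
  POS p η = p 0 ⊑ η × (∀ j → ¬ p (suc j) ⊑ η)

  module _ (n⁰ n¹ : ℕ → ℕ) where

    -- V is the partition ⟨V m : m* ≤ m < ω⟩ of ω; its values below m* are
    -- irrelevant.  Division by 2^m* is cleared.

    record IsWitness (p : ℕ → FinFun) (m* : ℕ) (V : ℕ → List ℕ) : Set where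
      field
        unique   : ∀ m → m* ≤ m → Unique (V m)
        cover    : ∀ j → ∃ λ m → m* ≤ m × j ∈ V m
        disjoint : ∀ m m′ → m* ≤ m → m* ≤ m′ → m ≢ m′ → Disjoint (V m) (V m′)
        few      : ∀ m → m* ≤ m → length (V m) ≤ n¹ m * 2 ^ m*
        large    : ∀ m j → m* ≤ m → j ∈ V m → n⁰ m ≤ length (dom (p (suc j))) * 2 ^ m*

    IsCondition : Pred (ℕ → FinFun) 0ℓ
    IsCondition p =
      (∀ k l → k ≢ l → Disjoint (dom (p k)) (dom (p l))) × ∃₂ (IsWitness p)

    ℚ : ForcingNotion 𝕏
    ℚ = record
      { Cond       = IsCondition
      ; Cond-resp  = cond-resp
      ; _≼_        = λ p q → POS q ⊆ POS p
      ; isPreorder = record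
        { isEquivalence = record
          { refl  = λ _ _ _ → refl
          ; sym   = λ x≈y n i i<n → sym (x≈y n i i<n)
          ; trans = λ x≈y y≈z n i i<n → trans (x≈y n i i<n) (y≈z n i i<n)
          }
        ; reflexive = λ p≈q {η} (w⊑ , σ⋢) →
            subst (_⊑ η) (sym (at p≈q 0)) w⊑ ,
            λ j σ⊑ → σ⋢ j (subst (_⊑ η) (at p≈q (suc j)) σ⊑)
        ; trans = λ p≼q q≼r η∈ → p≼q (q≼r η∈)
        }
      }
      where
      open Space 𝕏 using (_≈_)

      at : ∀ {p q} → p ≈ q → ∀ i → p i ≡ q i
      at p≈q i = p≈q (suc i) i ≤-refl

      cond-resp : IsCondition Respects _≈_
      cond-resp {p} {q} p≈q (dis , m* , V , wit) =
        (λ k l k≢l → subst (λ f → Disjoint f (dom (q l))) (cong dom (at p≈q k))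
                       (subst (Disjoint (dom (p k))) (cong dom (at p≈q l)) (dis k l k≢l))) ,
        m* , V , record
          { unique   = unique
          ; cover    = cover
          ; disjoint = disjoint
          ; few      = few
          ; large    = λ m j m*≤m j∈V →
              subst (λ f → n⁰ m ≤ length (dom f) * 2 ^ m*) (at p≈q (suc j)) (large m j m*≤m j∈V)
          }
        where open IsWitness wit

{-# OPTIONS --safe #-}
module Submission where

-- All three parts rest on one amalgamation theorem.  Let finitely many conditions share a
-- finite function w extending their w-parts and already violating every σⱼ of level < m*,
-- where m* is large.  The growth condition makes the domains at level m so big that, going
-- through the levels in increasing order, the points used at earlier levels can be thrown
-- away; within a level the overlapping domains of different conditions are made disjoint at
-- the cost of a constant factor, by splitting points evenly between two families (an
-- orientation of a finite multigraph with in- and out-degrees differing by at most one).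
-- The shrunken σⱼ together with w form a common upper bound, the constant factor being
-- absorbed by the larger m*.
--
-- Such a w is a finite piece of any η that lies in the given POS sets, or just satisfies
-- finitely many of the requirements defining them.  Hence there are countably many classes of
-- amalgamable conditions, conditions are compatible iff their POS sets meet, and both
-- POS q ⊆ POS p and incompatibility reduce to clauses that depend on finitely many coordinates
-- of p and q, which makes them Σ¹₁.

open import Defs hiding (_,_)
open import Level using (0ℓ)
open import Axiom.ExcludedMiddle using (ExcludedMiddle)
open import Data.Empty using (⊥-elim)
open import Data.Fin.Base as Fin using (Fin; toℕ)
open import Data.Fin.Properties using (toℕ-injective; toℕ<n; toℕ-fromℕ<)
open import Data.List.Base
  using (List; []; _∷_; _++_; _∷ʳ_; length; map; filter; take; upTo; concatMap; deduplicate; allFin)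
open import Data.List.Extrema.Nat using (max; xs≤max)
open import Data.List.Membership.Propositional using (_∈_; _∉_; find; lose)
open import Data.List.Membership.Propositional.Properties
open import Data.List.Properties
  using (length-++; length-map; length-take; length-tabulate; length-upTo; filter-accept; filter-reject; map-++; upTo-∷ʳ)
open import Data.List.Relation.Binary.Disjoint.Propositional using (Disjoint)
open import Data.List.Relation.Binary.Permutation.Propositional using (_↭_; prep; ↭⇒↭ₛ)
import Data.List.Relation.Binary.Permutation.Propositional.Properties as ↭
open import Data.List.Relation.Binary.Subset.Propositional using (_⊆_)
open import Data.List.Relation.Unary.All as All using (All; []; _∷_)
open import Data.List.Relation.Unary.All.Properties using (All¬⇒¬Any; ¬Any⇒All¬)
open import Data.List.Relation.Unary.AllPairs as AllPairs using ([]; _∷_)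
import Data.List.Relation.Unary.AllPairs.Properties as AllPairs
open import Data.List.Relation.Unary.Any using (Any; here; there; any?)
open import Data.List.Relation.Unary.Linked.Properties using (AllPairs⇒Linked; Linked⇒AllPairs)
open import Data.List.Relation.Unary.Unique.Propositional using (Unique)
import Data.List.Relation.Unary.Unique.Propositional.Properties as Unique
open import Data.Nat.Base
open import Data.Nat.DivMod
open import Data.Nat.ListAction using (sum)
open import Data.Nat.ListAction.Properties using (sum-++; sum-↭)
open import Data.Nat.Properties
open import Data.Nat.Tactic.RingSolver using (solve-∀)
open import Data.Product.Base using (Σ; ∃; ∃₂; _×_; _,_; proj₁; proj₂; swap)
open import Data.Sum.Base as Sum using (_⊎_; inj₁; inj₂)
open import Function.Base using (_∘_; id)
open import Function.Bundles using (_↣_; _⇔_; mk⇔; Equivalence; Injection)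
open import Relation.Binary.Definitions using (tri<; tri≈; tri>)
open import Relation.Binary.PropositionalEquality
  using (_≡_; _≢_; refl; sym; trans; cong; cong₂; subst; setoid; module ≡-Reasoning)
open import Relation.Nullary
open import Relation.Unary using (Pred)
open import Algebra.Properties.CommutativeSemigroup +-commutativeSemigroup using (interchange)
open import Data.List.Membership.DecPropositional _≟_ using (_∈?_; _∉?_)
open import Data.List.Relation.Binary.Permutation.Setoid.Properties (setoid ℕ) using (Unique-resp-↭)
open import Data.List.Relation.Unary.Unique.DecPropositional.Properties _≟_ using (deduplicate-!)

-- Balanced orientations

if?_then_else_ : ∀ {a} {P A : Set a} → Dec P → A → A → A
if? yes _ then x else y = x
if? no  _ then x else y = y

𝟙 : ℕ → ℕ → ℕ
𝟙 a x = if? (a ≟ x) then 1 else 0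

𝟙-≢ : ∀ {a x} → a ≢ x → 𝟙 a x ≡ 0
𝟙-≢ {a} {x} a≢x with a ≟ x
... | yes a≡x = contradiction a≡x a≢x
... | no _ = refl

𝟙≤1 : ∀ a x → 𝟙 a x ≤ 1
𝟙≤1 a x with a ≟ x
... | yes _ = ≤-refl
... | no _ = z≤n

-- Elements of `P` are read as edges of a multigraph and `f` as a choice of one end of each, so this
-- is an in- or out-degree of `x` when `f` gives heads or tails.
count : (ℕ → ℕ) → ℕ → List ℕ → ℕ
count f x P = sum (map (λ p → 𝟙 (f p) x) P)

count-↭ : ∀ f x {P Q} → P ↭ Q → count f x P ≡ count f x Q
count-↭ f x P↭Q = sum-↭ (↭.map⁺ (λ p → 𝟙 (f p) x) P↭Q)

count-cong : ∀ {f g} x P → (∀ {p} → p ∈ P → f p ≡ g p) → count f x P ≡ count g x P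
count-cong x [] f≗g = refl
count-cong x (p ∷ P) f≗g =
  cong₂ _+_ (cong (λ a → 𝟙 a x) (f≗g (here refl))) (count-cong x P (f≗g ∘ there))

count≡0 : ∀ {f x} P → (∀ {p} → p ∈ P → f p ≢ x) → count f x P ≡ 0
count≡0 [] f≢x = refl
count≡0 (p ∷ P) f≢x = cong₂ _+_ (𝟙-≢ (f≢x (here refl))) (count≡0 P (f≢x ∘ there))

_[_↦_] : (ℕ → ℕ) → ℕ → ℕ → ℕ → ℕ
(f [ p ↦ a ]) y = if? (y ≟ p) then a else f y

↦-same : ∀ f p a → (f [ p ↦ a ]) p ≡ a
↦-same f p a with p ≟ p
... | yes _ = refl
... | no p≢p = contradiction refl p≢p

↦-other : ∀ f a {p y} → y ≢ p → (f [ p ↦ a ]) y ≡ f y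
↦-other f a {p} {y} y≢p with y ≟ p
... | yes y≡p = contradiction y≡p y≢p
... | no _ = refl

SameEdge : (h t u v : ℕ) → Set
SameEdge h t u v = (h ≡ u × t ≡ v) ⊎ (h ≡ v × t ≡ u)

-- The ends of the edge `p` are `u p` and `v p`; its head and tail are `h p` and `t p`.
Reorients : List ℕ → (h t u v : ℕ → ℕ) → Set
Reorients P h t u v = ∀ {p} → p ∈ P → SameEdge (h p) (t p) (u p) (v p)

Balanced : List ℕ → (h t : ℕ → ℕ) → Set
Balanced P h t = ∀ x → count h x P ≤ suc (count t x P) × count t x P ≤ suc (count h x P)

private
  shuffle : ∀ a b {X Y} → a + X ≤ suc Y → a + (b + X) ≤ suc (b + Y)
  shuffle a b {X} {Y} le = begin
    a + (b + X)       ≡⟨ +-assoc a b X ⟨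
    (a + b) + X       ≡⟨ cong (_+ X) (+-comm a b) ⟩
    (b + a) + X       ≡⟨ +-assoc b a X ⟩
    b + (a + X)       ≤⟨ +-monoʳ-≤ b le ⟩
    b + suc Y         ≡⟨ +-suc b Y ⟩
    suc (b + Y)       ∎
    where open ≤-Reasoning

  shuffle′ : ∀ a b {X Y} → Y ≤ suc (a + X) → b + Y ≤ suc (a + (b + X))
  shuffle′ a b {X} {Y} le = begin
    b + Y             ≤⟨ +-monoʳ-≤ b le ⟩
    b + suc (a + X)   ≡⟨ +-suc b (a + X) ⟩
    suc (b + (a + X)) ≡⟨ cong suc (+-assoc b a X) ⟨
    suc ((b + a) + X) ≡⟨ cong (λ c → suc (c + X)) (+-comm b a) ⟩
    suc ((a + b) + X) ≡⟨ cong suc (+-assoc a b X) ⟩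
    suc (a + (b + X)) ∎
    where open ≤-Reasoning

  -- The new edge joins `a` to a vertex `z` that meets no other edge. At `z` both degrees are at
  -- most one; at `a` the new end goes to the side that is not ahead.
  attach-balanced : ∀ a z {X Y : ℕ → ℕ} → X z ≡ 0 → Y z ≡ 0 → X a ≤ Y a →
    (∀ x → X x ≤ suc (Y x) × Y x ≤ suc (X x)) →
    ∀ x → 𝟙 a x + X x ≤ suc (𝟙 z x + Y x) × 𝟙 z x + Y x ≤ suc (𝟙 a x + X x)
  attach-balanced a z {X} {Y} Xz Yz Xa≤Ya bal x with z ≟ x
  ... | yes refl rewrite Xz | Yz | +-identityʳ (𝟙 a z) =
    ≤-trans (𝟙≤1 a z) (s≤s z≤n) , s≤s z≤n
  ... | no _ with a ≟ x
  ...   | yes refl = s≤s Xa≤Ya , ≤-trans (proj₂ (bal a)) (n≤1+n _)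
  ...   | no _     = bal x

  unique-split : ∀ {p q : ℕ} ys {zs} → Unique (p ∷ ys ++ q ∷ zs) →
    p ≢ q × p ∉ ys ++ zs × q ∉ ys ++ zs × Unique (p ∷ ys ++ zs)
  unique-split {p} {q} ys {zs} pU
    with (p≢q ∷ p#) ∷ q# ∷ U ← Unique-resp-↭ (↭⇒↭ₛ (prep p (↭.shift q ys zs))) pU =
    p≢q , All¬⇒¬Any p# , All¬⇒¬Any q# , p# ∷ U

-- If some q ∈ R meets p in the vertex v p, the two edges are replaced by the single edge
-- joining their other ends; an orientation of it orients both coherently, so that v p gains
-- one incoming and one outgoing edge.  Otherwise p is a pendant edge at v p and is directed
-- so as to correct the balance at u p.
orient : ∀ n P → length P ≤ n → Unique P → ∀ u v →
  ∃₂ λ h t → Reorients P h t u v × Balanced P h t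
orient n [] _ _ u v = u , v , (λ ()) , λ _ → z≤n , z≤n
orient (suc n) (p ∷ R) (s≤s len) (p# ∷ R!) u v
  with any? (λ q → (u q ≟ v p) ⊎-dec (v q ≟ v p)) R
... | no none = finish (orient n R len R! u v)
  where
  p∉R : ∀ {q} → q ∈ R → q ≢ p
  p∉R q∈R q≡p = All¬⇒¬Any p# (subst (_∈ R) q≡p q∈R)

  module _ {h t} (re : Reorients R h t u v) where
    h-avoids : ∀ {q} → q ∈ R → h q ≢ v p
    h-avoids q∈R eq with re q∈R
    ... | inj₁ (e , _) = none (lose q∈R (inj₁ (trans (sym e) eq)))
    ... | inj₂ (e , _) = none (lose q∈R (inj₂ (trans (sym e) eq)))

    t-avoids : ∀ {q} → q ∈ R → t q ≢ v p
    t-avoids q∈R eq with re q∈R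
    ... | inj₁ (_ , e) = none (lose q∈R (inj₂ (trans (sym e) eq)))
    ... | inj₂ (_ , e) = none (lose q∈R (inj₁ (trans (sym e) eq)))

  cons-count : ∀ f a x → count (f [ p ↦ a ]) x (p ∷ R) ≡ 𝟙 a x + count f x R
  cons-count f a x = cong₂ _+_ (cong (λ b → 𝟙 b x) (↦-same f p a))
    (count-cong x R (λ q∈R → ↦-other f a (p∉R q∈R)))

  balance : ∀ {h t a b} →
    (∀ x → 𝟙 a x + count h x R ≤ suc (𝟙 b x + count t x R) ×
           𝟙 b x + count t x R ≤ suc (𝟙 a x + count h x R)) →
    Balanced (p ∷ R) (h [ p ↦ a ]) (t [ p ↦ b ])
  balance {h} {t} {a} {b} bal x rewrite cons-count h a x | cons-count t b x = bal x

  reorient : ∀ {h t a b} → SameEdge a b (u p) (v p) → Reorients R h t u v →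
    Reorients (p ∷ R) (h [ p ↦ a ]) (t [ p ↦ b ]) u v
  reorient {h} {t} {a} {b} same re (here refl)
    rewrite ↦-same h p a | ↦-same t p b = same
  reorient {h} {t} {a} {b} same re (there q∈R)
    rewrite ↦-other h a (p∉R q∈R) | ↦-other t b (p∉R q∈R) = re q∈R

  finish : (∃₂ λ h t → Reorients R h t u v × Balanced R h t) →
    ∃₂ λ h t → Reorients (p ∷ R) h t u v × Balanced (p ∷ R) h t
  finish (h , t , re , bal) with ≤-total (count h (u p) R) (count t (u p) R)
  ... | inj₁ h≤t = h [ p ↦ u p ] , t [ p ↦ v p ] , reorient (inj₁ (refl , refl)) re ,
    balance (attach-balanced (u p) (v p) (count≡0 R (h-avoids re)) (count≡0 R (t-avoids re)) h≤t bal)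
  ... | inj₂ t≤h = h [ p ↦ v p ] , t [ p ↦ u p ] , reorient (inj₂ (refl , refl)) re ,
    balance (swap ∘ attach-balanced (u p) (v p) (count≡0 R (t-avoids re)) (count≡0 R (h-avoids re)) t≤h (swap ∘ bal))
orient (suc n) (p ∷ R) (s≤s len) pR! u v | yes some
  with q , q∈R , meets ← find some
  with ys , zs , refl ← ∈-∃++ q∈R
  with p≢q , p∉ , q∉ , pR′! ← unique-split ys pR! = finish (other meets)
  where
  R′ = ys ++ zs

  other : (u q ≡ v p ⊎ v q ≡ v p) → ∃ λ w → SameEdge w (v p) (u q) (v q)
  other (inj₁ e) = v q , inj₂ (refl , sym e)
  other (inj₂ e) = u q , inj₁ (refl , sym e)

  perm : ys ++ q ∷ zs ↭ q ∷ R′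
  perm = ↭.shift q ys zs

  len′ : length (p ∷ R′) ≤ n
  len′ = subst (_≤ n) (↭.↭-length perm) len

  _‹_,_› : (ℕ → ℕ) → ℕ → ℕ → ℕ → ℕ
  f ‹ a , b › = (f [ p ↦ a ]) [ q ↦ b ]

  at-p : ∀ f a b → (f ‹ a , b ›) p ≡ a
  at-p f a b = trans (↦-other (f [ p ↦ a ]) b p≢q) (↦-same f p a)

  at-q : ∀ f a b → (f ‹ a , b ›) q ≡ b
  at-q f a b = ↦-same (f [ p ↦ a ]) q b

  ≢-∉ : ∀ {y z : ℕ} {xs} → y ∈ xs → z ∉ xs → y ≢ z
  ≢-∉ y∈ z∉ refl = z∉ y∈

  at-R′ : ∀ f a b {y} → y ∈ R′ → (f ‹ a , b ›) y ≡ f y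
  at-R′ f a b y∈ = trans (↦-other (f [ p ↦ a ]) b (≢-∉ y∈ q∉)) (↦-other f a (≢-∉ y∈ p∉))

  cons-count : ∀ f a b x →
    count (f ‹ a , b ›) x (p ∷ ys ++ q ∷ zs) ≡ 𝟙 a x + (𝟙 b x + count f x R′)
  cons-count f a b x = cong₂ _+_ (cong (λ c → 𝟙 c x) (at-p f a b))
    (trans (count-↭ (f ‹ a , b ›) x perm)
           (cong₂ _+_ (cong (λ c → 𝟙 c x) (at-q f a b)) (count-cong x R′ (at-R′ f a b))))

  reorient : ∀ {h t w hp tp hq tq} → Reorients (p ∷ R′) h t u (v [ p ↦ w ]) →
    SameEdge hp tp (u p) (v p) → SameEdge hq tq (u q) (v q) →
    Reorients (p ∷ ys ++ q ∷ zs) (h ‹ hp , hq ›) (t ‹ tp , tq ›) u v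
  reorient {h} {t} {w} {hp} {tp} {hq} {tq} re sp sq (here refl)
    rewrite at-p h hp hq | at-p t tp tq = sp
  reorient {h} {t} {w} {hp} {tp} {hq} {tq} re sp sq (there y∈) with ↭.∈-resp-↭ perm y∈
  ... | here refl rewrite at-q h hp hq | at-q t tp tq = sq
  ... | there y∈R′ rewrite at-R′ h hp hq y∈R′ | at-R′ t tp tq y∈R′ =
    subst (SameEdge (h _) (t _) (u _)) (↦-other v w (≢-∉ y∈R′ p∉)) (re (there y∈R′))

  finish : (∃ λ w → SameEdge w (v p) (u q) (v q)) →
    ∃₂ λ h t → Reorients (p ∷ ys ++ q ∷ zs) h t u v × Balanced (p ∷ ys ++ q ∷ zs) h t
  finish (w , wq)
    with h , t , re , bal ← orient n (p ∷ R′) len′ pR′! u (v [ p ↦ w ])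
    with re (here refl)
  ... | inj₁ (hp , tp) =
    h ‹ u p , v p › , t ‹ v p , w › ,
    reorient re (inj₁ (refl , refl)) (Sum.swap (Sum.map swap swap wq)) , balanced
    where
    balanced : Balanced (p ∷ ys ++ q ∷ zs) (h ‹ u p , v p ›) (t ‹ v p , w ›)
    balanced x with b₁ , b₂ ← bal x
      rewrite cons-count h (u p) (v p) x | cons-count t (v p) w x
            | hp | tp | ↦-same v p w =
      shuffle (𝟙 (u p) x) (𝟙 (v p) x) b₁ , shuffle′ (𝟙 (u p) x) (𝟙 (v p) x) b₂
  ... | inj₂ (hp , tp) =
    h ‹ v p , w › , t ‹ u p , v p › ,
    reorient re (inj₂ (refl , refl)) wq , balanced
    where
    balanced : Balanced (p ∷ ys ++ q ∷ zs) (h ‹ v p , w ›) (t ‹ u p , v p ›)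
    balanced x with b₁ , b₂ ← bal x
      rewrite cons-count h (v p) w x | cons-count t (u p) (v p) x
            | hp | tp | ↦-same v p w =
      shuffle′ (𝟙 (u p) x) (𝟙 (v p) x) b₁ , shuffle (𝟙 (u p) x) (𝟙 (v p) x) b₂

-- The heads of a balanced orientation serve: the degree of `x` is at least either of its two counts
-- and exceeds twice its in-degree by at most one.
halve : ∀ P → Unique P → ∀ u v → ∃ λ h →
  (∀ {p} → p ∈ P → h p ≡ u p ⊎ h p ≡ v p) ×
  (∀ x s → (2 * s ≤ count u x P ⊎ 2 * s ≤ count v x P) → s ≤ count h x P)
halve P P! u v with orient (length P) P ≤-refl P! u v
... | h , t , re , bal = h , Sum.map proj₁ proj₁ ∘ re , bound
  where
  open ≤-Reasoning

  degree : ∀ x Q → Reorients Q h t u v →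
    count h x Q + count t x Q ≡ count u x Q + count v x Q
  degree x [] re = refl
  degree x (p ∷ Q) re = begin-equality
    (𝟙 (h p) x + count h x Q) + (𝟙 (t p) x + count t x Q) ≡⟨ interchange (𝟙 (h p) x) _ _ _ ⟩
    (𝟙 (h p) x + 𝟙 (t p) x) + (count h x Q + count t x Q)
      ≡⟨ cong₂ _+_ (ends (re (here refl))) (degree x Q (re ∘ there)) ⟩
    (𝟙 (u p) x + 𝟙 (v p) x) + (count u x Q + count v x Q) ≡⟨ interchange (𝟙 (u p) x) _ _ _ ⟩
    (𝟙 (u p) x + count u x Q) + (𝟙 (v p) x + count v x Q) ∎
    where
    ends : ∀ {a b c d} → SameEdge a b c d → 𝟙 a x + 𝟙 b x ≡ 𝟙 c x + 𝟙 d x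
    ends (inj₁ (refl , refl)) = refl
    ends {a} {b} (inj₂ (refl , refl)) = +-comm (𝟙 a x) (𝟙 b x)

  half : ∀ s a → 2 * s ≤ a + suc a → s ≤ a
  half s a le with s ≤? a
  ... | yes s≤a = s≤a
  ... | no s≰a = contradiction (begin-strict
    a + suc a           <⟨ +-monoˡ-< (suc a) (n<1+n a) ⟩
    suc a + suc a       ≤⟨ +-mono-≤ (≰⇒> s≰a) (≰⇒> s≰a) ⟩
    s + s               ≡⟨ cong (s +_) (+-identityʳ s) ⟨
    2 * s               ≤⟨ le ⟩
    a + suc a           ∎) (<-irrefl refl)

  bound : ∀ x s → (2 * s ≤ count u x P ⊎ 2 * s ≤ count v x P) → s ≤ count h x P
  bound x s le = half s (count h x P) (begin
    2 * s                             ≤⟨ Sum.[ (λ l → ≤-trans l (m≤m+n _ _)) , (λ l → ≤-trans l (m≤n+m _ _)) ] le ⟩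
    count u x P + count v x P         ≡⟨ degree x P re ⟨
    count h x P + count t x P         ≤⟨ +-monoʳ-≤ (count h x P) (proj₂ (bal x)) ⟩
    count h x P + suc (count h x P)   ∎)

-- The `N + 1` families of labels are merged by halving against one new family at a time; each
-- family is halved at most `N` times.
split : ∀ P → Unique P → ∀ N (ℓ : ℕ → ℕ → ℕ) → ∃ λ h →
  (∀ {p} → p ∈ P → ∃ λ k → k ≤ N × h p ≡ ℓ k p) ×
  (∀ x s k → k ≤ N → 2 ^ N * s ≤ count (ℓ k) x P → s ≤ count h x P)
split P P! zero ℓ = ℓ 0 , (λ _ → 0 , z≤n , refl) ,
  λ { x s .0 z≤n le → ≤-trans (≤-reflexive (sym (+-identityʳ s))) le }
split P P! (suc N) ℓ
  with h₁ , mem₁ , big₁ ← split P P! N ℓ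
  with h , mem , big ← halve P P! h₁ (ℓ (suc N)) = h , mem′ , big′
  where
  mem′ : ∀ {p} → p ∈ P → ∃ λ k → k ≤ suc N × h p ≡ ℓ k p
  mem′ p∈P with mem p∈P
  ... | inj₂ e = suc N , ≤-refl , e
  ... | inj₁ e with k , k≤N , e′ ← mem₁ p∈P = k , m≤n⇒m≤1+n k≤N , trans e e′

  big′ : ∀ x s k → k ≤ suc N → 2 ^ suc N * s ≤ count (ℓ k) x P → s ≤ count h x P
  big′ x s k k≤ le with m≤n⇒m<n∨m≡n k≤
  ... | inj₁ (s≤s k≤N) = big x s (inj₁ (big₁ x (2 * s) k k≤N
        (≤-trans (≤-reflexive (trans (sym (*-assoc (2 ^ N) 2 s)) (cong (_* s) (*-comm (2 ^ N) 2)))) le)))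
  ... | inj₂ refl = big x s (inj₂ (≤-trans (*-monoˡ-≤ s (m≤m*n 2 (2 ^ N) {{m^n≢0 2 N}})) le))

-- Choosing disjoint subsets

length-mono-⊆ : ∀ {A : Set} {xs ys : List A} → Unique xs → xs ⊆ ys → length xs ≤ length ys
length-mono-⊆ {xs = []} _ _ = z≤n
length-mono-⊆ {xs = x ∷ xs} (x# ∷ xs!) xs⊆
  with as , bs , refl ← ∈-∃++ (xs⊆ (here refl)) =
  subst (suc (length xs) ≤_) (sym (↭.↭-length (↭.shift x as bs)))
    (s≤s (length-mono-⊆ xs! λ {z} z∈ → remove z∈ (xs⊆ (there z∈))))
  where
  remove : ∀ {z} → z ∈ xs → z ∈ as ++ x ∷ bs → z ∈ as ++ bs
  remove z∈ z∈′ with ↭.∈-resp-↭ (↭.shift x as bs) z∈′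
  ... | here refl = contradiction z∈ (All¬⇒¬Any x#)
  ... | there z∈″ = z∈″

count-filter : ∀ f x P → count f x P ≡ length (filter (λ p → f p ≟ x) P)
count-filter f x [] = refl
count-filter f x (p ∷ P) with f p ≟ x
... | yes e = trans (cong suc (count-filter f x P)) (cong length (sym (filter-accept (λ p → f p ≟ x) e)))
... | no ¬e = trans (count-filter f x P) (cong length (sym (filter-reject (λ p → f p ≟ x) ¬e)))

take-⊆ : ∀ {A : Set} n {xs : List A} → take n xs ⊆ xs
take-⊆ (suc n) {x ∷ xs} (here e) = here e
take-⊆ (suc n) {x ∷ xs} (there i) = there (take-⊆ n i)

length-concatMap-≤ : ∀ {A B : Set} (f : A → List B) {b} xs → (∀ x → length (f x) ≤ b) →
  length (concatMap f xs) ≤ length xs * b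
length-concatMap-≤ f [] _ = z≤n
length-concatMap-≤ f (x ∷ xs) le =
  ≤-trans (≤-reflexive (length-++ (f x))) (+-mono-≤ (le x) (length-concatMap-≤ f xs le))

module _ (em : ExcludedMiddle 0ℓ) where

  -- Sets `D x` of one family are disjoint, those of different families may overlap. Exactly
  -- `s (lev x)` points are chosen from each `D x`, the choices being disjoint from each other and
  -- from `U₀`.
  module Selection
    (lev : ℕ → ℕ) (W : ℕ → List ℕ) (∈W : ∀ x → x ∈ W (lev x))
    (D : ℕ → List ℕ) (D! : ∀ x → Unique (D x))
    (N : ℕ) (fam : ℕ → ℕ) (fam≤N : ∀ x → fam x ≤ N)
    (fam# : ∀ {x y} → x ≢ y → fam x ≡ fam y → Disjoint (D x) (D y))
    (s : ℕ → ℕ) (U₀ : List ℕ)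
    where

    load : ℕ → ℕ
    load zero    = length U₀
    load (suc m) = length (W m) * s m + load m

    module _ (large : ∀ x → 2 ^ N * s (lev x) + load (lev x) ≤ length (D x)) where

      module Stage (m : ℕ) (U : List ℕ) (U≤ : length U ≤ load m) where

        P : List ℕ
        P = deduplicate _≟_ (concatMap D (W m))

        Owner : ℕ → ℕ → Set
        Owner k p = ∃ λ x → lev x ≡ m × fam x ≡ k × p ∈ D x × p ∉ U

        -- The value 0 means that there is no owner, hence the shift by one. The owner is unique
        -- because the sets of a family are disjoint.
        label : ∀ {k p} → Dec (Owner k p) → ℕ
        label (yes (x , _)) = suc x
        label (no _)        = 0

        ℓ : ℕ → ℕ → ℕ
        ℓ k p = label (em {Owner k p})

        ℓ-sound : ∀ {k p x} → ℓ k p ≡ suc x → p ∈ D x × p ∉ U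
        ℓ-sound {k} {p} e with em {Owner k p}
        ℓ-sound refl | yes (x , _ , _ , p∈ , p∉) = p∈ , p∉

        ℓ-complete : ∀ {p x} → lev x ≡ m → p ∈ D x → p ∉ U → ℓ (fam x) p ≡ suc x
        ℓ-complete {p} {x} lx p∈ p∉ with em {Owner (fam x) p}
        ... | no none = contradiction (x , lx , refl , p∈ , p∉) none
        ... | yes (y , _ , fy , p∈y , _) with y ≟ x
        ...   | yes refl = refl
        ...   | no y≢x   = contradiction (p∈y , p∈) (fam# y≢x fy)

        P! : Unique P
        P! = deduplicate-! (concatMap D (W m))

        sp = split P P! N ℓ
        h = proj₁ sp

        E : ℕ → List ℕ
        -- Truncation keeps the number of spent points within `load` for the later stages.
        E x = take (s m) (filter (λ p → h p ≟ suc x) P)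

        ∈E : ∀ {x p} → p ∈ E x → p ∈ P × h p ≡ suc x
        ∈E {x} p∈ = ∈-filter⁻ (λ p → h p ≟ suc x) (take-⊆ (s m) p∈)

        E-sound : ∀ {x p} → p ∈ E x → p ∈ D x × p ∉ U
        E-sound p∈E with p∈P , hp ← ∈E p∈E
          with _ , _ , e ← proj₁ (proj₂ sp) p∈P = ℓ-sound (trans (sym e) hp)

        E# : ∀ {x y} → x ≢ y → Disjoint (E x) (E y)
        E# x≢y (p∈x , p∈y) =
          x≢y (suc-injective (trans (sym (proj₂ (∈E p∈x))) (proj₂ (∈E p∈y))))

        E! : ∀ x → Unique (E x)
        E! x = Unique.take⁺ (s m) (Unique.filter⁺ (λ p → h p ≟ suc x) P!)

        E-short : ∀ x → length (E x) ≤ s m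
        E-short x = ≤-trans (≤-reflexive (length-take (s m) (filter (λ p → h p ≟ suc x) P))) (m⊓n≤m _ _)

        -- At most `load m` points of `D x` are already spent. The others, at least `2 ^ N * s m` in
        -- number, carry the label of `x` in its family, so `split` leaves at least `s m` of them to
        -- `x`.
        E-length : ∀ x → lev x ≡ m → length (E x) ≡ s m
        E-length x refl = trans (length-take (s m) (filter (λ p → h p ≟ suc x) P)) (m≤n⇒m⊓n≡m
          (subst (s m ≤_) (count-filter h (suc x) P)
            (proj₂ (proj₂ sp) (suc x) (s m) (fam x) (fam≤N x) (≤-trans free≥ free≤))))
          where
          free = filter (_∉? U) (D x)

          covered : D x ⊆ free ++ U
          covered {p} p∈ with p ∈? U
          ... | yes p∈U = ∈-++⁺ʳ free p∈U
          ... | no p∉U  = ∈-++⁺ˡ (∈-filter⁺ (_∉? U) p∈ p∉U)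

          free≥ : 2 ^ N * s m ≤ length free
          free≥ = +-cancelʳ-≤ (load m) _ _ (begin
            2 ^ N * s m + load m     ≤⟨ large x ⟩
            length (D x)             ≤⟨ length-mono-⊆ (D! x) covered ⟩
            length (free ++ U)       ≡⟨ length-++ free ⟩
            length free + length U   ≤⟨ +-monoʳ-≤ (length free) U≤ ⟩
            length free + load m     ∎)
            where open ≤-Reasoning

          free⊆ : free ⊆ filter (λ p → ℓ (fam x) p ≟ suc x) P
          free⊆ {p} p∈free with p∈D , p∉U ← ∈-filter⁻ (_∉? U) p∈free =
            ∈-filter⁺ (λ p → ℓ (fam x) p ≟ suc x)
              (∈-deduplicate⁺ _≟_ (∈-concatMap⁺ D (lose (∈W x) p∈D)))
              (ℓ-complete refl p∈D p∉U)

          free≤ : length free ≤ count (ℓ (fam x)) (suc x) P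
          free≤ = subst (length free ≤_) (sym (count-filter (ℓ (fam x)) (suc x) P))
            (length-mono-⊆ (Unique.filter⁺ (_∉? U) (D! x)) free⊆)

      used : ∀ m → ∃ λ U → length U ≤ load m
      used zero    = U₀ , ≤-refl
      used (suc m) with U , U≤ ← used m =
        concatMap (Stage.E m U U≤) (W m) ++ U ,
        ≤-trans (≤-reflexive (length-++ (concatMap (Stage.E m U U≤) (W m))))
          (+-mono-≤ (length-concatMap-≤ (Stage.E m U U≤) (W m) (Stage.E-short m U U≤)) U≤)

      module At m = Stage m (proj₁ (used m)) (proj₂ (used m))

      E : ℕ → List ℕ
      E x = At.E (lev x) x

      used-mono : ∀ {m n} → m ≤′ n → proj₁ (used m) ⊆ proj₁ (used n)
      used-mono ≤′-refl = id
      used-mono {n = suc n} (≤′-step le) = ∈-++⁺ʳ (concatMap (At.E n) (W n)) ∘ used-mono le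

      E⊆D : ∀ x → E x ⊆ D x
      E⊆D x p∈ = proj₁ (At.E-sound (lev x) p∈)

      E#U₀ : ∀ x → Disjoint (E x) U₀
      E#U₀ x (p∈E , p∈U) = proj₂ (At.E-sound (lev x) p∈E) (used-mono {n = lev x} (≤⇒≤′ z≤n) p∈U)

      E! : ∀ x → Unique (E x)
      E! x = At.E! (lev x) x

      E-length : ∀ x → length (E x) ≡ s (lev x)
      E-length x = At.E-length (lev x) x refl

      private
        earlier : ∀ {x y} → lev x < lev y → Disjoint (E x) (E y)
        earlier {x} {y} lt (p∈x , p∈y) = proj₂ (At.E-sound (lev y) p∈y)
          (used-mono (≤⇒≤′ lt) (∈-++⁺ˡ (∈-concatMap⁺ (At.E (lev x)) (lose (∈W x) p∈x))))

      -- Different levels are separated by the record of used points, equal levels by the value of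
      -- `h`.
      E# : ∀ {x y} → x ≢ y → Disjoint (E x) (E y)
      E# {x} {y} x≢y with <-cmp (lev x) (lev y)
      ... | tri< lt _ _ = earlier lt
      ... | tri> _ _ gt = earlier gt ∘ swap
      ... | tri≈ _ e _  = λ (p∈x , p∈y) →
        At.E# (lev x) x≢y (p∈x , subst (λ m → _ ∈ At.E m y) (sym e) p∈y)

-- The growth condition

n≤2^n : ∀ n → n ≤ 2 ^ n
n≤2^n zero    = z≤n
n≤2^n (suc n) = ≤-trans (+-mono-≤ (m^n>0 2 n) (n≤2^n n))
  (≤-reflexive (cong (2 ^ n +_) (sym (+-identityʳ (2 ^ n)))))

Σ< : (ℕ → ℕ) → ℕ → ℕ
Σ< f zero    = 0
Σ< f (suc m) = f m + Σ< f m

Σ<-upTo : ∀ f m → sum (map f (upTo m)) ≡ Σ< f m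
Σ<-upTo f zero    = refl
Σ<-upTo f (suc m) = begin
  sum (map f (upTo (suc m)))          ≡⟨ cong (λ l → sum (map f l)) (upTo-∷ʳ m) ⟨
  sum (map f (upTo m ∷ʳ m))           ≡⟨ cong sum (map-++ f (upTo m) (m ∷ [])) ⟩
  sum (map f (upTo m) ++ f m ∷ [])    ≡⟨ sum-++ (map f (upTo m)) (f m ∷ []) ⟩
  sum (map f (upTo m)) + (f m + 0)    ≡⟨ cong₂ _+_ (Σ<-upTo f m) (+-identityʳ (f m)) ⟩
  Σ< f m + f m                        ≡⟨ +-comm (Σ< f m) (f m) ⟩
  f m + Σ< f m                        ∎
  where open ≡-Reasoning

Σ<-mono-≤ : ∀ {f g} → (∀ i → f i ≤ g i) → ∀ m → Σ< f m ≤ Σ< g m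
Σ<-mono-≤ f≤g zero    = z≤n
Σ<-mono-≤ f≤g (suc m) = +-mono-≤ (f≤g m) (Σ<-mono-≤ f≤g m)

Σ<-monoʳ-≤ : ∀ f {m n} → m ≤ n → Σ< f m ≤ Σ< f n
Σ<-monoʳ-≤ f {m} {n} m≤n = go (≤⇒≤′ m≤n)
  where
  go : ∀ {n} → m ≤′ n → Σ< f m ≤ Σ< f n
  go ≤′-refl      = ≤-refl
  go (≤′-step le) = ≤-trans (go le) (m≤n+m _ _)

module Growth {n⁰ n¹ : ℕ → ℕ} (nn : 𝐍 n⁰ n¹) where
  open 𝐍 nn

  -- `S` is the sum in the growth condition; up to a power of two, `T m` bounds the number of
  -- indices of level below `m`.
  S T : ℕ → ℕ
  S = Σ< (λ m → n⁰ m * n¹ m)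
  T = Σ< n¹

  0<n⁰ : ∀ m → 0 < n⁰ m
  0<n⁰ m = ≤-trans (s≤s z≤n) (4<n⁰ m)

  T≤S : ∀ m → T m ≤ S m
  T≤S = Σ<-mono-≤ λ m → m≤n*m (n¹ m) (n⁰ m) {{>-nonZero (0<n⁰ m)}}

  growth-S : ∀ m → 2 ^ (2 * (m + 2)) * S m ≤ n⁰ m
  growth-S m = subst (λ t → 2 ^ (2 * (m + 2)) * t ≤ n⁰ m) (Σ<-upTo (λ m → n⁰ m * n¹ m) m) (<⇒≤ (growth m))

  T≤n¹ : ∀ m → T m ≤ n¹ m
  T≤n¹ m = begin
    T m                        ≤⟨ T≤S m ⟩
    S m                        ≤⟨ m≤n*m (S m) (2 ^ (2 * (m + 2))) {{m^n≢0 2 (2 * (m + 2))}} ⟩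
    2 ^ (2 * (m + 2)) * S m    ≤⟨ growth-S m ⟩
    n⁰ m                       ≤⟨ n⁰≤n¹ m ⟩
    n¹ m                       ∎
    where open ≤-Reasoning

  0<S : ∀ {m} → 0 < m → 0 < S m
  0<S {suc m} _ = ≤-trans (*-mono-≤ (0<n⁰ m) (≤-trans (0<n⁰ m) (n⁰≤n¹ m))) (m≤m+n _ _)

  2^m≤n⁰ : ∀ m → 0 < m → 2 ^ m ≤ n⁰ m
  2^m≤n⁰ m 0<m = begin
    2 ^ m                      ≤⟨ ^-monoʳ-≤ 2 (≤-trans (m≤m+n m 2) (m≤n*m (m + 2) 2)) ⟩
    2 ^ (2 * (m + 2))          ≤⟨ m≤m*n _ (S m) {{>-nonZero (0<S 0<m)}} ⟩
    2 ^ (2 * (m + 2)) * S m    ≤⟨ growth-S m ⟩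
    n⁰ m                       ∎
    where open ≤-Reasoning

  -- The least s with n⁰ m ≤ s * 2 ^ m*, up to 1.
  demand : ℕ → ℕ → ℕ
  demand m* m = suc ((n⁰ m / 2 ^ m*) {{m^n≢0 2 m*}})

  module _ (m* : ℕ) where
    private instance
      _ = m^n≢0 2 m*

    demand-≥ : ∀ m → n⁰ m ≤ demand m* m * 2 ^ m*
    demand-≥ m = begin
      n⁰ m                                         ≡⟨ m≡m%n+[m/n]*n (n⁰ m) (2 ^ m*) ⟩
      n⁰ m % 2 ^ m* + n⁰ m / 2 ^ m* * 2 ^ m*       ≤⟨ +-monoˡ-≤ _ (<⇒≤ (m%n<n (n⁰ m) (2 ^ m*))) ⟩
      2 ^ m* + n⁰ m / 2 ^ m* * 2 ^ m*              ∎
      where open ≤-Reasoning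

    demand-*-≤ : ∀ m → demand m* m * 2 ^ m* ≤ 2 ^ m* + n⁰ m
    demand-*-≤ m = +-monoʳ-≤ (2 ^ m*) (m/n*n≤m (n⁰ m) (2 ^ m*))

    demand≤n⁰ : 0 < m* → ∀ m → demand m* m ≤ n⁰ m
    demand≤n⁰ 0<m* m =
      m/n<m (n⁰ m) (2 ^ m*) {{>-nonZero (0<n⁰ m)}} (^-monoʳ-≤ 2 0<m*)

  module _ (N μ : ℕ) where
    private
      m* = 3 + N + μ

      8* : ∀ N → 8 * (2 ^ μ * 2 ^ N) ≡ 2 ^ (3 + N + μ)
      8* N = begin
        8 * (2 ^ μ * 2 ^ N)              ≡⟨ cong (8 *_) (*-comm (2 ^ μ) (2 ^ N)) ⟩
        8 * (2 ^ N * 2 ^ μ)              ≡⟨ cong (8 *_) (^-distribˡ-+-* 2 N μ) ⟨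
        2 ^ 3 * 2 ^ (N + μ)              ≡⟨ ^-distribˡ-+-* 2 3 (N + μ) ⟨
        2 ^ (3 + (N + μ))                ∎
        where open ≡-Reasoning

    -- Here `L` counts spent points, `2 ^ N` is the loss in `split` and `2 ^ μ` the divisor in the
    -- size of the domains. After multiplication by 8 the demand costs at most `2 * n⁰ m` and, by
    -- growth, `L` at most `n⁰ m`.
    room : ∀ {m L} → m* ≤ m → L ≤ 2 ^ m* * (4 * S m) →
      2 ^ μ * (2 ^ N * demand m* m + L) ≤ n⁰ m
    room {m} {L} m*≤m L≤ = *-cancelˡ-≤ 8 (begin
      8 * (2 ^ μ * (2 ^ N * d + L))            ≡⟨ expand (2 ^ μ) (2 ^ N) d L ⟩
      d * (8 * (2 ^ μ * 2 ^ N)) + 8 * (2 ^ μ * 2 ^ 0) * L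
        ≡⟨ cong₂ (λ a b → d * a + b * L) (8* N) (8* 0) ⟩
      d * 2 ^ m* + 2 ^ (3 + μ) * L             ≤⟨ +-mono-≤ first second ⟩
      (n⁰ m + n⁰ m) + n⁰ m                     ≤⟨ m≤m+n _ (5 * n⁰ m) ⟩
      (n⁰ m + n⁰ m) + n⁰ m + 5 * n⁰ m          ≡⟨ collect (n⁰ m) ⟩
      8 * n⁰ m                                 ∎)
      where
      open ≤-Reasoning
      d = demand m* m

      0<m : 0 < m
      0<m = ≤-trans (s≤s z≤n) m*≤m

      expand : ∀ u n d L → 8 * (u * (n * d + L)) ≡ d * (8 * (u * n)) + 8 * (u * 1) * L
      expand = solve-∀

      collect : ∀ n → (n + n) + n + 5 * n ≡ 8 * n
      collect = solve-∀

      first : d * 2 ^ m* ≤ n⁰ m + n⁰ m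
      first = ≤-trans (demand-*-≤ m* m)
        (+-monoˡ-≤ (n⁰ m) (≤-trans (^-monoʳ-≤ 2 m*≤m) (2^m≤n⁰ m 0<m)))

      regroup : ∀ x y s → x * (y * (4 * s)) ≡ x * y * 4 * s
      regroup = solve-∀

      exponent : ∀ m → m + m + 2 ≤ 2 * (m + 2)
      exponent m = ≤-trans (m≤m+n _ 2) (≤-reflexive (e m))
        where
        e : ∀ m → m + m + 2 + 2 ≡ 2 * (m + 2)
        e = solve-∀

      second : 2 ^ (3 + μ) * L ≤ n⁰ m
      second = begin
        2 ^ (3 + μ) * L                        ≤⟨ *-mono-≤ (^-monoʳ-≤ 2 (≤-trans 3+μ≤m* m*≤m)) L≤ ⟩
        2 ^ m * (2 ^ m* * (4 * S m))           ≤⟨ *-monoʳ-≤ (2 ^ m) (*-monoˡ-≤ (4 * S m) (^-monoʳ-≤ 2 m*≤m)) ⟩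
        2 ^ m * (2 ^ m * (4 * S m))            ≡⟨ regroup (2 ^ m) (2 ^ m) (S m) ⟩
        2 ^ m * 2 ^ m * 2 ^ 2 * S m            ≡⟨ cong (λ t → t * 2 ^ 2 * S m) (^-distribˡ-+-* 2 m m) ⟨
        2 ^ (m + m) * 2 ^ 2 * S m              ≡⟨ cong (_* S m) (^-distribˡ-+-* 2 (m + m) 2) ⟨
        2 ^ (m + m + 2) * S m                  ≤⟨ *-monoˡ-≤ (S m) (^-monoʳ-≤ 2 (exponent m)) ⟩
        2 ^ (2 * (m + 2)) * S m                ≤⟨ growth-S m ⟩
        n⁰ m                                   ∎
        where
        3+μ≤m* : 3 + μ ≤ m*
        3+μ≤m* = s≤s (s≤s (s≤s (m≤n+m μ N)))

-- Amalgamation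

-- The number 2^x (2y + 1).
pair : ℕ → ℕ → ℕ
pair zero    y = suc (2 * y)
pair (suc x) y = 2 * pair x y

pair-injective : ∀ x {y} x′ {y′} → pair x y ≡ pair x′ y′ → x ≡ x′ × y ≡ y′
pair-injective zero    zero     e = refl , *-cancelˡ-≡ _ _ 2 (suc-injective e)
pair-injective zero {y} (suc x′) {y′} e = contradiction (sym e) (even≢odd (pair x′ y′) y)
pair-injective (suc x) {y} zero {y′} e = contradiction e (even≢odd (pair x y) y′)
pair-injective (suc x) (suc x′) e with refl , refl ← pair-injective x x′ (*-cancelˡ-≡ _ _ 2 e) =
  refl , refl

-- Finite functions and their restrictions

module FinFuns (em : ExcludedMiddle 0ℓ) {H : ℕ → Set} (default : ∀ i → H i) where
  open FinFun

  keys! : ∀ f → Unique (dom H f)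
  keys! f = AllPairs.map⁺ (AllPairs.map <⇒≢ (Linked⇒AllPairs <-trans (increasing f)))

  functional : ∀ f {i a b} → (i , a) ∈ graph f → (i , b) ∈ graph f → a ≡ b
  functional f = go (keys! f)
    where
    go : ∀ {G : List (Σ ℕ H)} {i a b} → Unique (map proj₁ G) → (i , a) ∈ G → (i , b) ∈ G → a ≡ b
    go _ (here refl) (here refl) = refl
    go (i# ∷ _) (here refl) (there b∈) = contradiction (∈-map⁺ proj₁ b∈) (All¬⇒¬Any i#)
    go (i# ∷ _) (there a∈) (here refl) = contradiction (∈-map⁺ proj₁ a∈) (All¬⇒¬Any i#)
    go (_ ∷ G!) (there a∈) (there b∈) = go G! a∈ b∈

  ∈dom⁻ : ∀ f {i} → i ∈ dom H f → ∃ λ a → (i , a) ∈ graph f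
  ∈dom⁻ f i∈ with (_ , a) , a∈ , refl ← ∈-map⁻ proj₁ i∈ = a , a∈

  ∈dom⁺ : ∀ f {i a} → (i , a) ∈ graph f → i ∈ dom H f
  ∈dom⁺ f = ∈-map⁺ proj₁

  -- `F` may be unordered and repetitive; filtering an initial segment of ω restores the canonical
  -- increasing listing.
  restrict : (∀ i → H i) → List ℕ → FinFun H
  restrict η F = record
    { graph      = map (λ i → i , η i) (filter (_∈? F) (upTo (suc (max 0 F))))
    ; increasing = AllPairs⇒Linked (AllPairs.map⁺ (AllPairs.filter⁺ (_∈? F)
        (AllPairs.applyUpTo⁺₁ id (suc (max 0 F)) λ i<j _ → i<j)))
    }

  ∈restrict⁺ : ∀ η F {i} → i ∈ F → (i , η i) ∈ graph (restrict η F)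
  ∈restrict⁺ η F i∈F = ∈-map⁺ _ (∈-filter⁺ (_∈? F)
    (∈-upTo⁺ (s≤s (All.lookup (xs≤max 0 F) i∈F))) i∈F)

  ∈restrict⁻ : ∀ η F {i a} → (i , a) ∈ graph (restrict η F) → i ∈ F × η i ≡ a
  ∈restrict⁻ η F a∈ with _ , i∈ , refl ← ∈-map⁻ (λ i → i , η i) a∈ =
    proj₂ (∈-filter⁻ (_∈? F) {xs = upTo (suc (max 0 F))} i∈) , refl

  ∈dom-restrict⁻ : ∀ η F {i} → i ∈ dom H (restrict η F) → i ∈ F
  ∈dom-restrict⁻ η F i∈ = proj₁ (∈restrict⁻ η F (proj₂ (∈dom⁻ (restrict η F) i∈)))

  length-restrict-≤ : ∀ η F → length (graph (restrict η F)) ≤ length F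
  length-restrict-≤ η F = subst (_≤ length F) (length-map proj₁ (graph (restrict η F)))
    (length-mono-⊆ (keys! (restrict η F)) (∈dom-restrict⁻ η F))

  length-restrict-≥ : ∀ η {F} → Unique F → length F ≤ length (dom H (restrict η F))
  length-restrict-≥ η {F} F! =
    length-mono-⊆ F! (λ i∈F → ∈dom⁺ (restrict η F) (∈restrict⁺ η F i∈F))

  -- Makes `f` total so that `restrict` applies to it; on subsets of `dom H f` the default value
  -- never enters.
  extend : FinFun H → ∀ i → H i
  extend f i with em {∃ λ a → (i , a) ∈ graph f}
  ... | yes (a , _) = a
  ... | no _        = default i

  extend-≡ : ∀ f {i a} → (i , a) ∈ graph f → extend f i ≡ a
  extend-≡ f {i} a∈ with em {∃ λ a → (i , a) ∈ graph f}
  ... | yes (b , b∈) = functional f b∈ a∈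
  ... | no none      = contradiction (_ , a∈) none

  restrict-extend-⊑ : ∀ f {F η} → F ⊆ dom H f → _⊑_ H f η → _⊑_ H (restrict (extend f) F) η
  restrict-extend-⊑ f {F} {η} F⊆ f⊑ = All.tabulate (λ {(_ , _)} → agree)
    where
    agree : ∀ {i a} → (i , a) ∈ graph (restrict (extend f) F) → η i ≡ a
    agree a∈
      with i∈ , refl ← ∈restrict⁻ _ F a∈
      with b , b∈ ← ∈dom⁻ f (F⊆ i∈) =
      trans (All.lookup f⊑ b∈) (sym (extend-≡ f b∈))

  extend-⊑ : ∀ f → _⊑_ H f (extend f)
  extend-⊑ f = All.tabulate (λ {(_ , _)} a∈ → extend-≡ f a∈)

  -- A finite reason why no η can extend both graphs.
  Clash : List (Σ ℕ H) → List (Σ ℕ H) → Set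
  Clash F G = ∃ λ i → ∃₂ λ a b → (i , a) ∈ F × (i , b) ∈ G × a ≢ b

-- Level functions of conditions

module Conditions (em : ExcludedMiddle 0ℓ) {n⁰ n¹ : ℕ → ℕ} (nn : 𝐍 n⁰ n¹)
                  {H : ℕ → Set} (default : ∀ i → H i) where
  open FinFun
  open FinFuns em default
  open Growth nn
  open 𝐍 nn

  -- What amalgamation uses of a witness: a level for each index, and a bound on the indices of all
  -- levels below `m` together.
  record Levelled (p : ℕ → FinFun H) (M : ℕ) : Set where
    field
      lev   : ℕ → ℕ
      few   : ∀ m → ∃ λ W → length W ≤ 2 ^ M * T m × (∀ j → lev j < m → j ∈ W)
      large : ∀ j → n⁰ (lev j) ≤ length (dom H (p (suc j))) * 2 ^ M

  levelled : ∀ {p M V} → IsWitness H n⁰ n¹ p M V → Levelled p M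
  levelled {p} {M} {V} wit = record
    { lev   = lev
    ; few   = λ m → below m , below-≤ m , λ j → ∈below m
    ; large = λ j → W.large (lev j) j (proj₁ (proj₂ (W.cover j))) (proj₂ (proj₂ (W.cover j)))
    }
    where
    module W = IsWitness wit
    open ≤-Reasoning

    lev : ℕ → ℕ
    lev j = proj₁ (W.cover j)

    layer : ∀ {m} → Dec (M ≤ m) → List ℕ
    layer {m} (yes _) = V m
    layer     (no _)  = []

    below : ℕ → List ℕ
    below zero    = []
    below (suc m) = layer (M ≤? m) ++ below m

    layer-≤ : ∀ {m} (M≤?m : Dec (M ≤ m)) → length (layer M≤?m) ≤ 2 ^ M * n¹ m
    layer-≤ {m} (yes M≤m) = ≤-trans (W.few m M≤m) (≤-reflexive (*-comm (n¹ m) (2 ^ M)))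
    layer-≤ (no _) = z≤n

    below-≤ : ∀ m → length (below m) ≤ 2 ^ M * T m
    below-≤ zero    = z≤n
    below-≤ (suc m) = begin
      length (layer (M ≤? m) ++ below m)              ≡⟨ length-++ (layer (M ≤? m)) ⟩
      length (layer (M ≤? m)) + length (below m)      ≤⟨ +-mono-≤ (layer-≤ (M ≤? m)) (below-≤ m) ⟩
      2 ^ M * n¹ m + 2 ^ M * T m                      ≡⟨ *-distribˡ-+ (2 ^ M) (n¹ m) (T m) ⟨
      2 ^ M * T (suc m)                               ∎

    ∈layer : ∀ {j} (M≤? : Dec (M ≤ lev j)) → j ∈ layer M≤?
    ∈layer {j} (yes _) = proj₂ (proj₂ (W.cover j))
    ∈layer {j} (no M≰) = contradiction (proj₁ (proj₂ (W.cover j))) M≰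

    ∈below : ∀ m {j} → lev j < m → j ∈ below m
    ∈below (suc m) {j} (s≤s le) with m≤n⇒m<n∨m≡n le
    ... | inj₁ lt   = ∈-++⁺ʳ (layer (M ≤? m)) (∈below m lt)
    ... | inj₂ refl = ∈-++⁺ˡ (∈layer (M ≤? m))

  -- Index sets of equal level form a partition by themselves; the lists `W m` need only contain
  -- them, since repetitions and other indices are filtered out.
  witness : ∀ {p m*} (lev : ℕ → ℕ) → (∀ j → m* ≤ lev j) →
    (∀ m → ∃ λ W → length W ≤ n¹ m * 2 ^ m* × (∀ j → lev j ≡ m → j ∈ W)) →
    (∀ j → n⁰ (lev j) ≤ length (dom H (p (suc j))) * 2 ^ m*) →
    ∃ (IsWitness H n⁰ n¹ p m*)
  witness {p} {m*} lev m*≤ W large = V , record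
    { unique   = λ m _ → V! m
    ; cover    = λ j → lev j , m*≤ j ,
        ∈-filter⁺ (λ j → lev j ≟ _) (∈-deduplicate⁺ _≟_ (proj₂ (proj₂ (W (lev j))) j refl)) refl
    ; disjoint = λ m m′ _ _ m≢m′ (j∈ , j∈′) → m≢m′ (trans (sym (lev-V j∈)) (lev-V j∈′))
    ; few      = λ m _ → ≤-trans
        (length-mono-⊆ (V! m) (∈-deduplicate⁻ _≟_ (proj₁ (W m)) ∘ proj₁ ∘ ∈-filter⁻ (λ j → lev j ≟ m)))
        (proj₁ (proj₂ (W m)))
    ; large    = λ m j _ j∈ → subst (λ l → n⁰ l ≤ length (dom H (p (suc j))) * 2 ^ m*) (lev-V j∈) (large j)
    }
    where
    V : ℕ → List ℕ
    V m = filter (λ j → lev j ≟ m) (deduplicate _≟_ (proj₁ (W m)))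

    V! : ∀ m → Unique (V m)
    V! m = Unique.filter⁺ (λ j → lev j ≟ m) (deduplicate-! (proj₁ (W m)))

    lev-V : ∀ {m j} → j ∈ V m → lev j ≡ m
    lev-V {m} j∈ = proj₂ (∈-filter⁻ (λ j → lev j ≟ m) {xs = deduplicate _≟_ (proj₁ (W m))} j∈)

  Cond : (ℕ → FinFun H) → Set
  Cond = IsCondition H n⁰ n¹

  nonempty : ∀ {p} → Cond p → ∀ j → ∃ λ i → i ∈ dom H (p (suc j))
  nonempty {p} (_ , m* , V , wit) j = inhabitant (dom H (p (suc j))) (L.large j)
    where
    module L = Levelled (levelled wit)
    inhabitant : ∀ xs → n⁰ (L.lev j) ≤ length xs * 2 ^ m* → ∃ (_∈ xs)
    inhabitant []      le = contradiction (≤-trans (0<n⁰ (L.lev j)) le) λ ()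
    inhabitant (x ∷ _) _  = x , here refl

  -- The `m*` of the upper bound: `μ` covers the parameters of the given conditions, `N` the loss in
  -- splitting, and 3 the remaining constant factors.
  threshold : ℕ → ℕ → ℕ
  threshold N μ = 3 + N + μ

  -- `G` is the graph of the shared `w`. It refutes every σⱼ of level below the threshold, so room
  -- is needed only from there on.
  record Ready (N μ : ℕ) (G : List (Σ ℕ H)) (p : ℕ → FinFun H) : Set where
    field
      M      : ℕ
      levels : Levelled p M
    open Levelled levels public
    field
      M≤μ    : M ≤ μ
      w⊆G    : graph (p 0) ⊆ G
      clash  : ∀ j → lev j < threshold N μ → Clash (graph (p (suc j))) G

  -- The points of `w` are lost at every level; this bound keeps them within the estimate of `room`.
  Small : ℕ → ℕ → List (Σ ℕ H) → Set
  Small N μ G = length G ≤ 2 ^ threshold N μ * (1 + S (threshold N μ))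

  module Amalgamation (n μ : ℕ) (w : FinFun H) (small : Small (suc n) μ (graph w))
    (q : Fin (suc n) → ℕ → FinFun H) (cond : ∀ k → Cond (q k))
    (ready : ∀ k → Ready (suc n) μ (graph w) (q k))
    where
    module R k = Ready (ready k)

    N = suc n
    m* = threshold N μ

    -- Division by `N` identifies pairs (k, j) with natural numbers, so that the members of all
    -- `q k` form the single sequence `σ`.
    enc : Fin N → ℕ → ℕ
    enc k j = toℕ k + j * N

    fst : ℕ → Fin N
    fst x = x mod N

    snd : ℕ → ℕ
    snd x = x / N

    enc-fst-snd : ∀ x → enc (fst x) (snd x) ≡ x
    enc-fst-snd x = trans (cong (_+ snd x * N) (toℕ-fromℕ< (m%n<n x N))) (sym (m≡m%n+[m/n]*n x N))

    fst-enc : ∀ k j → fst (enc k j) ≡ k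
    fst-enc k j = toℕ-injective (trans (toℕ-fromℕ< (m%n<n (enc k j) N))
      (trans ([m+kn]%n≡m%n (toℕ k) j N) (m<n⇒m%n≡m (toℕ<n k))))

    snd-enc : ∀ k j → snd (enc k j) ≡ j
    snd-enc k j = *-cancelʳ-≡ (snd (enc k j)) j N (+-cancelˡ-≡ (toℕ k) _ _
      (trans (cong (λ k′ → toℕ k′ + snd (enc k j) * N) (sym (fst-enc k j))) (enc-fst-snd (enc k j))))

    σ : ℕ → FinFun H
    σ x = q (fst x) (suc (snd x))

    -- Members of the q k that are already refuted by w keep their index, with a block of the
    -- partition {pair x i ∣ x, i} as new domain; these blocks form the additional family N.
    Killed : ℕ → Set
    Killed x = Clash (graph (σ x)) (graph w)

    lev : ℕ → ℕ
    -- Only killed members can be raised by this: for the others `ready` gives a level of at least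
    -- `m*`.
    lev x = R.lev (fst x) (snd x) ⊔ m*

    m*≤lev : ∀ x → m* ≤ lev x
    m*≤lev x = m≤n⊔m _ _

    W : ℕ → List ℕ
    -- `R.few` lists levels strictly below its argument, hence `suc m`.
    W m = concatMap (λ k → map (enc k) (proj₁ (R.few k (suc m)))) (allFin N)

    ∈W : ∀ x → x ∈ W (lev x)
    ∈W x = ∈-concatMap⁺ _ (lose (∈-allFin (fst x))
      (subst (_∈ map (enc (fst x)) (proj₁ (R.few (fst x) (suc (lev x))))) (enc-fst-snd x)
        (∈-map⁺ (enc (fst x)) (proj₂ (proj₂ (R.few (fst x) (suc (lev x)))) (snd x)
          (s≤s (m≤m⊔n _ _))))))

    W-few : ∀ m → length (W m) ≤ n¹ m * 2 ^ m*
    W-few m = begin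
      length (W m)                          ≤⟨ length-concatMap-≤ (λ k → map (enc k) (proj₁ (R.few k (suc m)))) (allFin N) layer ⟩
      length (allFin N) * (2 ^ μ * T (suc m)) ≡⟨ cong (_* (2 ^ μ * T (suc m))) (length-tabulate {n = N} id) ⟩
      N * (2 ^ μ * (n¹ m + T m))            ≤⟨ *-mono-≤ (n≤2^n N) (*-monoʳ-≤ (2 ^ μ) (+-monoʳ-≤ (n¹ m) (T≤n¹ m))) ⟩
      2 ^ N * (2 ^ μ * (n¹ m + n¹ m))       ≤⟨ m≤m+n _ (3 * (2 ^ N * (2 ^ μ * (n¹ m + n¹ m)))) ⟩
      2 ^ N * (2 ^ μ * (n¹ m + n¹ m)) + 3 * (2 ^ N * (2 ^ μ * (n¹ m + n¹ m))) ≡⟨ collect (2 ^ N) (2 ^ μ) (n¹ m) ⟩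
      n¹ m * (2 ^ 3 * 2 ^ N * 2 ^ μ)        ≡⟨ cong (λ t → n¹ m * (t * 2 ^ μ)) (^-distribˡ-+-* 2 3 N) ⟨
      n¹ m * (2 ^ (3 + N) * 2 ^ μ)          ≡⟨ cong (n¹ m *_) (^-distribˡ-+-* 2 (3 + N) μ) ⟨
      n¹ m * 2 ^ m*                         ∎
      where
      open ≤-Reasoning
      layer : ∀ k → length (map (enc k) (proj₁ (R.few k (suc m)))) ≤ 2 ^ μ * T (suc m)
      layer k = ≤-trans (≤-reflexive (length-map (enc k) (proj₁ (R.few k (suc m)))))
        (≤-trans (proj₁ (proj₂ (R.few k (suc m)))) (*-monoˡ-≤ (T (suc m)) (^-monoʳ-≤ 2 (R.M≤μ k))))
      collect : ∀ a b c → a * (b * (c + c)) + 3 * (a * (b * (c + c))) ≡ c * (8 * a * b)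
      collect = solve-∀

    D′ : ∀ x → Dec (Killed x) → List ℕ
    D′ x (yes _) = map (pair x) (upTo (n⁰ (lev x)))
    D′ x (no _)  = dom H (σ x)

    fam′ : ∀ x → Dec (Killed x) → ℕ
    fam′ x (yes _) = N
    fam′ x (no _)  = toℕ (fst x)

    D : ℕ → List ℕ
    D x = D′ x em

    D! : ∀ x → Unique (D x)
    D! x with em {Killed x}
    ... | yes _ = Unique.map⁺ (λ e → proj₂ (pair-injective x x e)) (Unique.upTo⁺ _)
    ... | no _  = keys! (σ x)

    fam : ℕ → ℕ
    fam x = fam′ x em

    fam≤N : ∀ x → fam x ≤ N
    fam≤N x with em {Killed x}
    ... | yes _ = ≤-refl
    ... | no _  = <⇒≤ (toℕ<n (fst x))

    fam# : ∀ {x y} → x ≢ y → fam x ≡ fam y → Disjoint (D x) (D y)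
    fam# {x} {y} x≢y e with em {Killed x} | em {Killed y}
    ... | yes _ | yes _ = λ (i∈x , i∈y) → blocks i∈x i∈y
      where
      blocks : ∀ {i} → i ∈ map (pair x) (upTo (n⁰ (lev x))) → i ∉ map (pair y) (upTo (n⁰ (lev y)))
      blocks i∈x i∈y with _ , _ , e₁ ← ∈-map⁻ (pair x) i∈x | _ , _ , e₂ ← ∈-map⁻ (pair y) i∈y =
        x≢y (proj₁ (pair-injective x y (trans (sym e₁) e₂)))
    ... | yes _ | no _  = contradiction (sym e) (<⇒≢ (toℕ<n (fst y)))
    ... | no _  | yes _ = contradiction e (<⇒≢ (toℕ<n (fst x)))
    ... | no _  | no _  = subst (λ k → Disjoint (dom H (σ x)) (dom H (q k (suc (snd y))))) same
      (proj₁ (cond (fst x)) (suc (snd x)) (suc (snd y)) λ e′ → x≢y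
        (trans (sym (enc-fst-snd x)) (trans (cong₂ enc same (suc-injective e′)) (enc-fst-snd y))))
      where
      same : fst x ≡ fst y
      same = toℕ-injective e

    open Selection em lev W ∈W D D! N fam fam≤N fam# (demand m*) (dom H w)

    -- The first summand pays for `w`. Level `m` adds at most `n¹ m * 2 ^ m*` sets of at most `n⁰ m`
    -- points, which is `2 ^ m*` times the next term of `S`.
    load-≤ : ∀ m → load m ≤ 2 ^ m* * (1 + S m*) + 2 ^ m* * S m
    load-≤ zero    = ≤-trans (≤-reflexive (length-map proj₁ (graph w))) (≤-trans small (m≤m+n _ _))
    load-≤ (suc m) = begin
      length (W m) * demand m* m + load m
        ≤⟨ +-mono-≤ (*-mono-≤ (W-few m) (demand≤n⁰ m* (s≤s z≤n) m)) (load-≤ m) ⟩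
      n¹ m * 2 ^ m* * n⁰ m + (2 ^ m* * (1 + S m*) + 2 ^ m* * S m)
        ≡⟨ collect (n¹ m) (2 ^ m*) (n⁰ m) (S m*) (S m) ⟩
      2 ^ m* * (1 + S m*) + 2 ^ m* * S (suc m) ∎
      where
      open ≤-Reasoning
      collect : ∀ a b c d e → a * b * c + (b * (1 + d) + b * e) ≡ b * (1 + d) + b * (c * a + e)
      collect = solve-∀

    space : ∀ x → 2 ^ μ * (2 ^ N * demand m* (lev x) + load (lev x)) ≤ n⁰ (lev x)
    space x = room N μ (m*≤lev x) (begin
      load m                                   ≤⟨ load-≤ m ⟩
      2 ^ m* * (1 + S m*) + 2 ^ m* * S m
        ≤⟨ +-monoˡ-≤ (2 ^ m* * S m) (*-monoʳ-≤ (2 ^ m*) (+-mono-≤ (0<S (≤-trans (s≤s z≤n) (m*≤lev x))) (Σ<-monoʳ-≤ _ (m*≤lev x)))) ⟩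
      2 ^ m* * (S m + S m) + 2 ^ m* * S m      ≤⟨ m≤m+n _ (2 ^ m* * S m) ⟩
      2 ^ m* * (S m + S m) + 2 ^ m* * S m + 2 ^ m* * S m ≡⟨ collect (2 ^ m*) (S m) ⟩
      2 ^ m* * (4 * S m)                       ∎)
      where
      open ≤-Reasoning
      m = lev x
      collect : ∀ a b → a * (b + b) + a * b + a * b ≡ a * (4 * b)
      collect = solve-∀

    ample : ∀ x → 2 ^ N * demand m* (lev x) + load (lev x) ≤ length (D x)
    ample x with em {Killed x}
    ... | yes _ = begin
      _                          ≤⟨ m≤n*m _ (2 ^ μ) {{m^n≢0 2 μ}} ⟩
      _                          ≤⟨ space x ⟩
      n⁰ (lev x)                 ≡⟨ length-upTo (n⁰ (lev x)) ⟨
      length (upTo (n⁰ (lev x))) ≡⟨ length-map (pair x) (upTo (n⁰ (lev x))) ⟨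
      _                          ∎
      where open ≤-Reasoning
    ... | no alive = *-cancelˡ-≤ (2 ^ M) {{m^n≢0 2 M}} (begin
      2 ^ M * need                   ≤⟨ *-monoˡ-≤ need (^-monoʳ-≤ 2 (R.M≤μ (fst x))) ⟩
      2 ^ μ * need                   ≤⟨ space x ⟩
      n⁰ (lev x)                     ≡⟨ cong n⁰ (m≥n⇒m⊔n≡m high) ⟩
      n⁰ (R.lev (fst x) (snd x))     ≤⟨ R.large (fst x) (snd x) ⟩
      length (dom H (σ x)) * 2 ^ M   ≡⟨ *-comm _ (2 ^ M) ⟩
      2 ^ M * length (dom H (σ x))   ∎)
      where
      open ≤-Reasoning
      M = R.M (fst x)
      need = 2 ^ N * demand m* (lev x) + load (lev x)
      high : m* ≤ R.lev (fst x) (snd x)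
      high = ≮⇒≥ (alive ∘ R.clash (fst x) (snd x))

    r : ℕ → FinFun H
    r zero    = w
    -- For killed `x` the values are arbitrary: one more function to be avoided only shrinks `POS`.
    r (suc x) = restrict (extend (σ x)) (E ample x)

    r-cond : Cond r
    r-cond = disjoint , m* , witness lev m*≤lev
      (λ m → W m , W-few m , λ { x refl → ∈W x }) large
      where
      disjoint : ∀ k l → k ≢ l → Disjoint (dom H (r k)) (dom H (r l))
      disjoint zero    zero    0≢0 = contradiction refl 0≢0
      disjoint zero    (suc y) _ (i∈ , i∈′) =
        E#U₀ ample y (∈dom-restrict⁻ _ (E ample y) i∈′ , i∈)
      disjoint (suc x) zero    _ (i∈ , i∈′) =
        E#U₀ ample x (∈dom-restrict⁻ _ (E ample x) i∈ , i∈′)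
      disjoint (suc x) (suc y) x≢y (i∈ , i∈′) =
        E# ample (x≢y ∘ cong suc) (∈dom-restrict⁻ _ (E ample x) i∈ , ∈dom-restrict⁻ _ (E ample y) i∈′)

      large : ∀ x → n⁰ (lev x) ≤ length (dom H (r (suc x))) * 2 ^ m*
      large x = ≤-trans (demand-≥ m* (lev x)) (*-monoˡ-≤ (2 ^ m*)
        (≤-trans (≤-reflexive (sym (E-length ample x))) (length-restrict-≥ _ (E! ample x))))

    -- If η extended a member of `q k`, that member would either clash with `w` or have its
    -- restriction, which `r` forbids, contained in η.
    r-bound : ∀ k {η} → POS H r η → POS H (q k) η
    r-bound k {η} (w⊑ , avoids) =
      All.tabulate (λ a∈ → All.lookup w⊑ (R.w⊆G k a∈)) ,
      λ j σ⊑ → refute (enc k j)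
        (subst (λ f → _⊑_ H f η) (sym (cong₂ (λ k j → q k (suc j)) (fst-enc k j) (snd-enc k j))) σ⊑)
      where
      refute : ∀ x → ¬ (_⊑_ H (σ x) η)
      refute x σ⊑ = avoids x (go (em {Killed x}) (E⊆D ample x))
        where
        go : (kx : Dec (Killed x)) → (∀ {i} → i ∈ E ample x → i ∈ D′ x kx) →
          _⊑_ H (restrict (extend (σ x)) (E ample x)) η
        go (yes (i , a , b , a∈ , b∈ , a≢b)) _ =
          contradiction (trans (sym (All.lookup σ⊑ a∈)) (All.lookup w⊑ b∈)) a≢b
        go (no _) E⊆ = restrict-extend-⊑ (σ x) E⊆ σ⊑

-- Σ¹₁ sets

Antitone : Space → Set
Antitone S = ∀ {m n x y} → m ≤ n → Space.Agree S n x y → Space.Agree S m x y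

Seq-antitone : ∀ {D} → Antitone (Seq D)
Seq-antitone m≤n ag i i<m = ag i (<-≤-trans i<m m≤n)

×-antitone : ∀ {S T} → Antitone S → Antitone T → Antitone (S ×ˢ T)
×-antitone s t m≤n (a , b) = s m≤n a , t m≤n b

interleave : (f g : ℕ → ℕ) → ℕ → ℕ
interleave f g zero          = f 0
interleave f g (suc zero)    = g 0
interleave f g (suc (suc n)) = interleave (f ∘ suc) (g ∘ suc) n

evens odds : (ℕ → ℕ) → ℕ → ℕ
evens f n = f (n + n)
odds  f n = f (suc (n + n))

evens-interleave : ∀ f g n → evens (interleave f g) n ≡ f n
evens-interleave f g zero    = refl
evens-interleave f g (suc n) rewrite +-suc n n = evens-interleave (f ∘ suc) (g ∘ suc) n

odds-interleave : ∀ f g n → odds (interleave f g) n ≡ g n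
odds-interleave f g zero    = refl
odds-interleave f g (suc n) rewrite +-suc n n = odds-interleave (f ∘ suc) (g ∘ suc) n

module _ {S : Space} where
  open Space S

  -- Rejecting x as a member of R takes finite information about x only.
  LocalAt : Pred Carrier 0ℓ → Carrier → Set
  LocalAt R x = ∃ λ n → ∀ {y} → Agree n x y → R y → R x

  ⋂-closed : {I : Set} {R : I → Pred Carrier 0ℓ} → (∀ i x → LocalAt (R i) x) →
    Closed S (λ x → ∀ i → R i x)
  ⋂-closed loc x lim i with n , back ← loc i x with y , Cy , ag ← lim n = back ag (Cy i)

  Σ¹₁-⇔ : ∀ {P Q : Pred Carrier 0ℓ} → (∀ x → P x ⇔ Q x) → Σ¹₁ S P → Σ¹₁ S Q
  Σ¹₁-⇔ P⇔Q (C , closed , proj) = C , closed , λ x → mk⇔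
    (Equivalence.to (proj x) ∘ Equivalence.from (P⇔Q x))
    (Equivalence.to (P⇔Q x) ∘ Equivalence.from (proj x))

  -- The Baire coordinate is a choice function `f`. The requirement at `m` involves `f m` alone and
  -- is rejected by finite information about `x`, so the conjunction is closed.
  Σ¹₁-∀∃ : Antitone S → {R : ℕ → ℕ → Pred Carrier 0ℓ} → (∀ m k x → LocalAt (R m k) x) →
    Σ¹₁ S (λ x → ∀ m → ∃ λ k → R m k x)
  Σ¹₁-∀∃ anti {R} loc = (λ (x , f) → ∀ m → R m (f m) x) , closed ,
    λ x → mk⇔ (λ choice → proj₁ ∘ choice , proj₂ ∘ choice) (λ (f , r) m → f m , r m)
    where
    closed : Closed (S ×ˢ Baire) (λ (x , f) → ∀ m → R m (f m) x)
    closed (x , f) lim m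
      with n , back ← loc m (f m) x
      with (y , g) , r , ag , f≗g ← lim (n ⊔ suc m) =
      back (anti (m≤m⊔n n (suc m)) ag)
        (subst (λ k → R m k y) (sym (f≗g m (m≤n⊔m n (suc m)))) (r m))

  module _ (refl-agree : ∀ n x → Agree n x x) where

    Σ¹₁-∩ : Antitone S → {P Q : Pred Carrier 0ℓ} → Σ¹₁ S P → Σ¹₁ S Q → Σ¹₁ S (λ x → P x × Q x)
    Σ¹₁-∩ anti {P} {Q} (C , C-closed , C-proj) (D , D-closed , D-proj) =
      (λ (x , f) → C (x , evens f) × D (x , odds f)) ,
      joint-closed ,
      λ x → mk⇔
        (λ (Px , Qx) →
          let f , Cf = Equivalence.to (C-proj x) Px
              g , Dg = Equivalence.to (D-proj x) Qx
          in interleave f g ,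
             -- `evens (interleave f g)` equals `f` only pointwise; closedness carries membership
             -- over.
             C-closed _ (λ n → _ , Cf , refl-agree n x , λ i _ → evens-interleave f g i) ,
             D-closed _ (λ n → _ , Dg , refl-agree n x , λ i _ → odds-interleave f g i))
        (λ (f , Cf , Df) →
          Equivalence.from (C-proj x) (_ , Cf) , Equivalence.from (D-proj x) (_ , Df))
      where
      joint-closed : Closed (S ×ˢ Baire) (λ (x , f) → C (x , evens f) × D (x , odds f))
      joint-closed (x , f) lim =
        C-closed _ (λ n →
          let (y , g) , (Cy , _) , ag , f≗g = lim (n + n)
          in (y , evens g) , Cy , anti (m≤m+n n n) ag , λ i i<n → f≗g (i + i) (+-mono-< i<n i<n)) ,
        D-closed _ (λ n →
          let (y , g) , (_ , Dy) , ag , f≗g = lim (suc (n + n))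
          in (y , odds g) , Dy , anti (m≤n⇒m≤1+n (m≤m+n n n)) ag ,
             λ i i<n → f≗g (suc (i + i)) (s≤s (+-mono-< i<n i<n)))

Σ¹₁-pullback : ∀ {S T} (g : Space.Carrier T → Space.Carrier S) →
  (∀ {n x y} → Space.Agree T n x y → Space.Agree S n (g x) (g y)) →
  ∀ {P} → Σ¹₁ S P → Σ¹₁ T (P ∘ g)
Σ¹₁-pullback g cont (C , closed , proj) =
  (λ (x , f) → C (g x , f)) ,
  (λ (x , f) lim → closed _ λ n →
    let (y , h) , Cy , ag , f≗h = lim n in (g y , h) , Cy , cont ag , f≗h) ,
  (λ x → proj (g x))

-- Least elements and finite enumerations

module Classical (em : ExcludedMiddle 0ℓ) where

  Least : (ℕ → Set) → ℕ → Set
  Least P m = P m × (∀ i → P i → m ≤ i)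

  least : ∀ {P : ℕ → Set} → ∃ P → ∃ (Least P)
  least {P} (n , Pn) = Sum.[ id , (λ none → contradiction (none n Pn) (<-irrefl refl)) ] (search (suc n))
    where
    search : ∀ b → ∃ (Least P) ⊎ (∀ i → P i → b ≤ i)
    search zero = inj₂ λ _ _ → z≤n
    search (suc b) with search b
    ... | inj₁ found = inj₁ found
    ... | inj₂ none with em {P b}
    ...   | yes Pb = inj₁ (b , Pb , none)
    ...   | no ¬Pb = inj₂ λ i Pi → ≤∧≢⇒< (none i Pi) λ { refl → ¬Pb Pi }

  -- A duplicate-free list of the full length exhausts `P`; if there is none, the bound can be
  -- lowered.
  enumerate : ∀ (P : ℕ → Set) b → (∀ L → Unique L → All P L → length L ≤ b) →
    ∃ λ W → length W ≤ b × (∀ j → P j → j ∈ W)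
  enumerate P zero bound = [] , z≤n , λ j Pj →
    contradiction (bound (j ∷ []) ([] ∷ []) (Pj ∷ [])) λ ()
  enumerate P (suc b) bound
    with em {∃ λ L → Unique L × All P L × length L ≡ suc b}
  ... | yes (L , L! , LP , len) = L , ≤-reflexive len , complete
    where
    complete : ∀ j → P j → j ∈ L
    complete j Pj with em {j ∈ L}
    ... | yes j∈L = j∈L
    ... | no j∉L = contradiction
      (bound (j ∷ L) (¬Any⇒All¬ L j∉L ∷ L!) (Pj ∷ LP))
      (<⇒≱ (s≤s (≤-reflexive (sym len))))
  ... | no none = let W , W≤ , complete = enumerate P b bound′ in W , m≤n⇒m≤1+n W≤ , complete
    where
    bound′ : ∀ L → Unique L → All P L → length L ≤ b
    bound′ L L! LP with m≤n⇒m<n∨m≡n (bound L L! LP)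
    ... | inj₁ (s≤s le) = le
    ... | inj₂ len      = contradiction (L , L! , LP , len) none

-- Elements of POS sets and compatibility

module Forcing (em : ExcludedMiddle 0ℓ) {n⁰ n¹ : ℕ → ℕ} (nn : 𝐍 n⁰ n¹)
               {H : ℕ → Set} (two : ∀ i → ∃₂ λ (a b : H i) → a ≢ b) where

  default : ∀ i → H i
  default i = proj₁ (two i)

  other : ∀ i (a : H i) → ∃ λ b → b ≢ a
  other i a with em {a ≡ default i}
  ... | yes refl = proj₁ (proj₂ (two i)) , proj₂ (proj₂ (two i)) ∘ sym
  ... | no a≢    = default i , a≢ ∘ sym

  open FinFun
  open FinFuns em default
  open Growth nn
  open Conditions em nn default
  open Classical em
  open ForcingNotion (ℚ H n⁰ n¹) using (Compatible; _≼_)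

  infix 4 _⊑′_
  _⊑′_ : FinFun H → (∀ i → H i) → Set
  _⊑′_ = _⊑_ H

  Approx : ℕ → (ℕ → FinFun H) → (∀ i → H i) → Set
  Approx J p η = p 0 ⊑′ η × (∀ k → k < J → ¬ p (suc k) ⊑′ η)

  POS⇒Approx : ∀ p {η} J → POS H p η → Approx J p η
  POS⇒Approx p J (w⊑ , avoids) = w⊑ , λ k _ → avoids k

  module _ {p} (cond : Cond p) (J : ℕ) (η : ∀ i → H i) (approx : Approx J p η) where

    Late : ℕ → Set
    Late i = ∃ λ k → J ≤ k × ∃ λ a → (i , a) ∈ graph (p (suc k))

    -- On the domain of each σₖ with `J ≤ k` the value is made to differ from σₖ. Since domains are
    -- disjoint, this is unambiguous and leaves η unchanged on the domains of the `w`-part and of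
    -- the earlier σₖ.
    modify : ∀ i → H i
    modify i with em {Late i}
    ... | yes (_ , _ , a , _) = proj₁ (other i a)
    ... | no _                = η i

    modify-early : ∀ {i} → ¬ Late i → modify i ≡ η i
    modify-early {i} early with em {Late i}
    ... | yes late = contradiction late early
    ... | no _     = refl

    modify-late : ∀ {i a} k → J ≤ k → (i , a) ∈ graph (p (suc k)) → modify i ≢ a
    modify-late {i} {a} k J≤k a∈ with em {Late i}
    ... | no early = contradiction (k , J≤k , a , a∈) early
    ... | yes (k′ , _ , a′ , a′∈) with k ≟ k′
    ...   | yes refl rewrite functional (p (suc k)) a∈ a′∈ = proj₂ (other i a′)
    ...   | no k≢k′  = contradiction (∈dom⁺ (p (suc k)) a∈ , ∈dom⁺ (p (suc k′)) a′∈)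
      (proj₁ cond (suc k) (suc k′) (k≢k′ ∘ suc-injective))

    modify-on : ∀ l → (∀ k → J ≤ k → l ≢ suc k) → p l ⊑′ modify → p l ⊑′ η
    modify-on l early ⊑m = All.tabulate λ {(i , _)} a∈ → trans
      (sym (modify-early λ (k , J≤k , _ , b∈) → proj₁ cond l (suc k) (early k J≤k) (∈dom⁺ (p l) a∈ , ∈dom⁺ (p (suc k)) b∈)))
      (All.lookup ⊑m a∈)

    modify-∈POS : POS H p modify
    modify-∈POS =
      All.tabulate (λ {(i , _)} a∈ → trans
        (modify-early λ (k , _ , _ , b∈) → proj₁ cond 0 (suc k) (λ ()) (∈dom⁺ (p 0) a∈ , ∈dom⁺ (p (suc k)) b∈))
        (All.lookup (proj₁ approx) a∈)) ,
      avoids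
      where
      avoids : ∀ k → ¬ p (suc k) ⊑′ modify
      avoids k σ⊑ with J ≤? k
      ... | no J≰k = proj₂ approx k (≰⇒> J≰k)
        (modify-on (suc k) (λ { _ J≤k refl → J≰k J≤k }) σ⊑)
      ... | yes J≤k with i , i∈ ← nonempty cond k with a , a∈ ← ∈dom⁻ (p (suc k)) i∈ =
        modify-late k J≤k a∈ (All.lookup σ⊑ a∈)

  POS-inhabited : ∀ {p} → Cond p → ∃ (POS H p)
  POS-inhabited {p} cond =
    _ , modify-∈POS cond 0 (extend (p 0)) (extend-⊑ (p 0) , λ _ ())

  -- Each point of `F` lies in the domain of at most one σₖ.
  avoided : ∀ {p} → Cond p → ∀ (F : List ℕ) →
    ∃ λ J → ∀ k → J ≤ k → ∀ {i} → i ∈ F → i ∉ dom H (p (suc k))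
  avoided cond [] = 0 , λ _ _ ()
  avoided {p} cond (i ∷ F) with J , J-avoids ← avoided cond F | em {∃ λ k → i ∈ dom H (p (suc k))}
  ... | no none = J , λ where
    k J≤k (here refl) i∈ → none (k , i∈)
    k J≤k (there i∈F)    → J-avoids k J≤k i∈F
  ... | yes (k₀ , i∈₀) = J ⊔ suc k₀ , λ where
    k J≤k (here refl) i∈ → proj₁ cond (suc k₀) (suc k)
      (<⇒≢ (s≤s (m⊔n≤o⇒n≤o J (suc k₀) J≤k))) (i∈₀ , i∈)
    k J≤k (there i∈F) → J-avoids k (m⊔n≤o⇒m≤o J (suc k₀) J≤k) i∈F

  approximable : ∀ {p} → Cond p → ∀ F → ∃ λ J → ∀ η → Approx J p η →
    ∃ λ η′ → POS H p η′ × (∀ {i} → i ∈ F → η′ i ≡ η i)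
  approximable {p} cond F with J , J-avoids ← avoided cond F = J , λ η approx →
    modify cond J η approx , modify-∈POS cond J η approx ,
    λ i∈F → modify-early cond J η approx
      λ (k , J≤k , _ , a∈) → J-avoids k J≤k i∈F (∈dom⁺ (p (suc k)) a∈)

  disagreement : ∀ f {η} → ¬ f ⊑′ η → ∃₂ λ i a → (i , a) ∈ graph f × a ≢ η i
  disagreement f {η} f⋢ with em {∃₂ λ i a → (i , a) ∈ graph f × a ≢ η i}
  ... | yes found = found
  ... | no none = contradiction (All.tabulate λ {(i , a)} a∈ → agree a∈ (em {a ≡ η i})) f⋢
    where
    agree : ∀ {i a} → (i , a) ∈ graph f → Dec (a ≡ η i) → η i ≡ a
    agree a∈ (yes e) = sym e
    agree a∈ (no ≢)  = contradiction (_ , _ , a∈ , ≢) none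

  module _ {p M} (L : Levelled p M) (m : ℕ) (η : ∀ i → H i)
           (w⊑ : p 0 ⊑′ η) (avoids : ∀ j → Levelled.lev L j < m → ¬ p (suc j) ⊑′ η) where
    open Levelled L

    point : ∀ {j} → Dec (lev j < m) → ℕ
    point {j} (yes lt) = proj₁ (disagreement (p (suc j)) (avoids j lt))
    point (no _)   = 0

    -- Where η must be remembered: on the domain of the `w`-part, and at one disagreement with each
    -- σⱼ of level below `m`. Other listed indices contribute a harmless 0.
    points : List ℕ
    points = dom H (p 0) ++ map (λ j → point (lev j <? m)) (proj₁ (few m))

    length-points : length points ≤ length (graph (p 0)) + 2 ^ M * T m
    length-points = ≤-trans (≤-reflexive (length-++ (dom H (p 0))))
      (+-mono-≤ (≤-reflexive (length-map proj₁ (graph (p 0))))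
                (≤-trans (≤-reflexive (length-map _ (proj₁ (few m)))) (proj₁ (proj₂ (few m)))))

    points-clash : ∀ {F} → points ⊆ F → ∀ j → lev j < m →
      Clash (graph (p (suc j))) (graph (restrict η F))
    points-clash {F} ⊆F j lt = go (lev j <? m) (⊆F (∈-++⁺ʳ (dom H (p 0)) (∈-map⁺ _ (proj₂ (proj₂ (few m)) j lt))))
      where
      go : (d : Dec (lev j < m)) → point d ∈ F → Clash (graph (p (suc j))) (graph (restrict η F))
      go (no ≮) _ = contradiction lt ≮
      go (yes lt) i∈ with i , a , a∈ , a≢ ← disagreement (p (suc j)) (avoids j lt) =
        i , a , η i , a∈ , ∈restrict⁺ η F i∈ , a≢

    points-w : ∀ {F} → points ⊆ F → graph (p 0) ⊆ graph (restrict η F)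
    points-w {F} ⊆F {i , a} a∈ with refl ← All.lookup w⊑ a∈ =
      ∈restrict⁺ η F (⊆F (∈-++⁺ˡ (∈dom⁺ (p 0) a∈)))

  abstract
    -- Neither `μ` nor `J` depends on η: `J` exceeds every listed index of level below the threshold
    -- in both conditions, and η only determines `w`. The complexity bounds rely on this uniformity.
    common-ready : ∀ N {p q} → Cond p → Cond q → ∃₂ λ μ J → ∀ η → Approx J p η → Approx J q η →
      ∃ λ w → Small N μ (graph w) × Ready N μ (graph w) p × Ready N μ (graph w) q
    common-ready N {p} {q} (_ , M₀ , _ , wit₀) (_ , M₁ , _ , wit₁) = μ , J , λ η ap aq →
      let ⊑p = λ j lt → proj₂ ap j (in-J (∈-++⁺ˡ (proj₂ (proj₂ (L₀.few m)) j lt)))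
          ⊑q = λ j lt → proj₂ aq j (in-J (∈-++⁺ʳ (proj₁ (L₀.few m)) (proj₂ (proj₂ (L₁.few m)) j lt)))
          F₀ = points L₀ m η (proj₁ ap) ⊑p
          F₁ = points L₁ m η (proj₁ aq) ⊑q
      in restrict η (F₀ ++ F₁) ,
         ≤-trans (length-restrict-≤ η (F₀ ++ F₁)) (≤-trans (≤-reflexive (length-++ F₀))
           (≤-trans (+-mono-≤ (length-points L₀ m η (proj₁ ap) ⊑p) (length-points L₁ m η (proj₁ aq) ⊑q)) bound)) ,
         record { M = M₀ ; levels = L₀
                ; M≤μ = ≤-trans (m≤m+n M₀ M₁) (m≤m+n _ _)
                ; w⊆G = points-w L₀ m η (proj₁ ap) ⊑p ∈-++⁺ˡ
                ; clash = points-clash L₀ m η (proj₁ ap) ⊑p ∈-++⁺ˡ } ,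
         record { M = M₁ ; levels = L₁
                ; M≤μ = ≤-trans (m≤n+m M₁ M₀) (m≤m+n _ _)
                ; w⊆G = points-w L₁ m η (proj₁ aq) ⊑q (∈-++⁺ʳ F₀)
                ; clash = points-clash L₁ m η (proj₁ aq) ⊑q (∈-++⁺ʳ F₀) }
      where
      L₀ : Levelled p M₀
      L₀ = levelled wit₀
      L₁ : Levelled q M₁
      L₁ = levelled wit₁
      module L₀ = Levelled L₀
      module L₁ = Levelled L₁
      l₀ l₁ μ m : ℕ
      l₀ = length (graph (p 0))
      l₁ = length (graph (q 0))
      -- The lengths of the `w`-parts are included so that `2 ^ μ` bounds their share in the size of
      -- `w`.
      μ = M₀ + M₁ + (l₀ + l₁)
      m = threshold N μ
      Ws : List ℕ
      Ws = proj₁ (L₀.few m) ++ proj₁ (L₁.few m)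
      J : ℕ
      J = suc (max 0 Ws)

      in-J : ∀ {j} → j ∈ Ws → j < J
      in-J j∈ = s≤s (All.lookup (xs≤max 0 Ws) j∈)

      1+μ≤m : suc μ ≤ m
      1+μ≤m = s≤s (≤-trans (m≤n+m μ N) (≤-trans (n≤1+n _) (n≤1+n _)))

      bound : (l₀ + 2 ^ M₀ * T m) + (l₁ + 2 ^ M₁ * T m) ≤ 2 ^ m * (1 + S m)
      bound = begin
        (l₀ + 2 ^ M₀ * T m) + (l₁ + 2 ^ M₁ * T m)
          ≤⟨ +-mono-≤ (+-monoʳ-≤ l₀ (below M₀ (≤-trans (m≤m+n M₀ M₁) (m≤m+n _ _))))
                      (+-monoʳ-≤ l₁ (below M₁ (≤-trans (m≤n+m M₁ M₀) (m≤m+n _ _)))) ⟩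
        (l₀ + 2 ^ μ * S m) + (l₁ + 2 ^ μ * S m)
          ≡⟨ collect l₀ l₁ (2 ^ μ) (S m) ⟩
        (l₀ + l₁) + 2 ^ suc μ * S m
          ≤⟨ +-mono-≤ (≤-trans (m≤n+m (l₀ + l₁) (M₀ + M₁)) (≤-trans (n≤2^n μ) (^-monoʳ-≤ 2 (<⇒≤ 1+μ≤m))))
                      (*-monoˡ-≤ (S m) (^-monoʳ-≤ 2 1+μ≤m)) ⟩
        2 ^ m + 2 ^ m * S m  ≡⟨ *-suc (2 ^ m) (S m) ⟨
        2 ^ m * (1 + S m)    ∎
        where
        open ≤-Reasoning
        below : ∀ M → M ≤ μ → 2 ^ M * T m ≤ 2 ^ μ * S m
        below M M≤μ = *-mono-≤ (^-monoʳ-≤ 2 M≤μ) (T≤S m)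
        collect : ∀ a b c d → (a + c * d) + (b + c * d) ≡ (a + b) + 2 * c * d
        collect = solve-∀

  abstract
    amalgamate : ∀ n μ w → Small (suc n) μ (graph w) → (q : Fin (suc n) → ℕ → FinFun H) →
      (∀ k → Cond (q k)) → (∀ k → Ready (suc n) μ (graph w) (q k)) →
      ∃ λ r → Cond r × (∀ k → q k ≼ r)
    amalgamate n μ w small q cond ready = r , r-cond , λ k → r-bound k
      where open Amalgamation n μ w small q cond ready

  abstract
    compatible : ∀ {p q} → Cond p → Cond q → ∃ λ J → ∀ η → Approx J p η → Approx J q η → Compatible p q
    compatible {p} {q} cp cq = let μ , J , ready = common-ready 2 cp cq in J , λ η ap aq →
      let w , small , rp , rq = ready η ap aq
          r , cr , bound = amalgamate 1 μ w small pq
            (λ { Fin.zero → cp ; (Fin.suc _) → cq }) (λ { Fin.zero → rp ; (Fin.suc _) → rq })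
      in r , cr , bound Fin.zero , bound (Fin.suc Fin.zero)
      where
      pq : Fin 2 → ℕ → FinFun H
      pq Fin.zero    = p
      pq (Fin.suc _) = q

  compatible⇔ : ∀ p q → Cond p → Cond q → Compatible p q ⇔ (∃ λ η → POS H p η × POS H q η)
  compatible⇔ p q cp cq = mk⇔
    (λ (r , cr , p≼r , q≼r) → let η , η∈ = POS-inhabited cr in η , p≼r η∈ , q≼r η∈)
    (λ (η , η∈p , η∈q) → let J , comp = compatible cp cq in
      comp η (POS⇒Approx p J η∈p) (POS⇒Approx q J η∈q))

-- Linkedness and complexity

module Complexity (em : ExcludedMiddle 0ℓ) {n⁰ n¹ : ℕ → ℕ} (nn : 𝐍 n⁰ n¹)
               {H : ℕ → Set} (code : ∀ i → H i ↣ ℕ)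
               (two : ∀ i → ∃₂ λ (a b : H i) → a ≢ b) where
  open Classical em
  open Forcing em nn two
  open FinFun
  open FinFuns em default
  open Conditions em nn default
  open ForcingNotion (ℚ H n⁰ n¹) hiding (Cond)

  -- Countability of the `H i` enters here: there are only countably many finite functions.
  codeᵍ : List (Σ ℕ H) → ℕ
  codeᵍ []            = 0
  codeᵍ ((i , a) ∷ G) = suc (pair (pair i (Injection.to (code i) a)) (codeᵍ G))

  codeᵍ-injective : ∀ G G′ → codeᵍ G ≡ codeᵍ G′ → G ≡ G′
  codeᵍ-injective []            []              _ = refl
  codeᵍ-injective ((i , a) ∷ G) ((i′ , a′) ∷ G′) e
    with e₁ , e₂ ← pair-injective (pair i (Injection.to (code i) a)) _ (suc-injective e)
    with refl , e₃ ← pair-injective i i′ e₁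
    with refl ← Injection.injective (code i) e₃ = cong (_ ∷_) (codeᵍ-injective G G′ e₂)

  at : ∀ {p q : ℕ → FinFun H} → p ≈ q → ∀ i → p i ≡ q i
  at p≈q i = p≈q (suc i) i ≤-refl

  Ready-resp : ∀ {N μ G p q} → p ≈ q → Ready N μ G p → Ready N μ G q
  Ready-resp {G = G} p≈q rdy = record
    { M      = M
    ; levels = record
      { lev   = lev
      ; few   = few
      ; large = λ j → subst (λ f → n⁰ (lev j) ≤ length (dom H f) * 2 ^ M) (at p≈q (suc j)) (large j)
      }
    ; M≤μ    = M≤μ
    ; w⊆G    = subst (λ f → graph f ⊆ G) (at p≈q 0) w⊆G
    ; clash  = λ j lt → subst (λ f → Clash (graph f) G) (at p≈q (suc j)) (clash j lt)
    }
    where open Ready rdy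

  Coded : ℕ → (ℕ → FinFun H) → ℕ → Set
  Coded N p i = ∃₂ λ μ w → pair μ (codeᵍ (graph w)) ≡ i × Small N μ (graph w) × Ready N μ (graph w) p

  -- A condition may have many codes; taking the least one makes the pieces disjoint.
  Piece : ℕ → ℕ → (ℕ → FinFun H) → Set
  Piece N i p = Cond p × Least (Coded N p) i

  ≈-sym : ∀ {p q : ℕ → FinFun H} → p ≈ q → q ≈ p
  ≈-sym p≈q n i i<n = sym (p≈q n i i<n)

  Coded-resp : ∀ {N p q i} → p ≈ q → Coded N p i → Coded N q i
  Coded-resp p≈q (μ , w , e , small , rdy) = μ , w , e , small , Ready-resp p≈q rdy

  linked : σ-*-Linked
  linked n = Piece (suc n) , record
    { resp     = λ i p≈q (cp , coded , least-i) →
        ForcingNotion.Cond-resp (ℚ H n⁰ n¹) p≈q cp , Coded-resp p≈q coded ,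
        λ i′ c → least-i i′ (Coded-resp (≈-sym p≈q) c)
    ; sound    = λ i → proj₁
    ; cover    = λ p cp → let i , l = least (coded p cp) in i , cp , l
    ; disjoint = λ i j p (_ , ci , li) (_ , cj , lj) → ≤-antisym (li j cj) (lj i ci)
    } , bound
    where
    coded : ∀ p → Cond p → ∃ (Coded (suc n) p)
    coded p cp =
      -- A single condition is handled as the pair of `p` with itself.
      let μ , J , ready  = common-ready (suc n) cp cp
          η , η∈         = POS-inhabited cp
          w , s , r , _  = ready η (POS⇒Approx p J η∈) (POS⇒Approx p J η∈)
      in _ , μ , w , refl , s , r

    bound : ∀ i (q : Fin (suc n) → ℕ → FinFun H) → (∀ k → Piece (suc n) i (q k)) →
      ∃ λ r → Cond r × (∀ k → q k ≼ r)
    bound i q pieces with μ , w , e , small , _ ← proj₁ (proj₂ (pieces Fin.zero)) =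
      amalgamate n μ w small q (proj₁ ∘ pieces) ready
      where
      ready : ∀ k → Ready (suc n) μ (graph w) (q k)
      -- Equal codes mean equal `μ` and equal graphs of `w`.
      ready k with μ′ , w′ , e′ , _ , rdy ← proj₁ (proj₂ (pieces k))
        with refl , e″ ← pair-injective μ′ μ (trans e′ (sym e)) =
        subst (λ G → Ready (suc n) μ G (q k)) (codeᵍ-injective _ _ e″) rdy

  -- Two conditions in one piece are compatible, so an antichain meets each piece in at most one
  -- point up to `≈`.
  ccc : CCC
  ccc A (A⊆Cond , anti) = enum , found
    where
    piece = linked 1
    P = proj₁ piece
    open IsPartition (proj₁ (proj₂ piece))

    Meets : ℕ → Set
    Meets n = ∃ λ p → A p × P n p

    enum : ℕ → ℕ → FinFun H
    enum n with em {Meets n}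
    ... | yes (p , _) = p
    ... | no _        = λ _ → restrict default []

    found : ∀ p → A p → ∃ λ n → enum n ≈ p
    found p Ap = let n , Pp = cover p (A⊆Cond Ap) in n , same n Pp
      where
      same : ∀ n → P n p → enum n ≈ p
      same n Pp with em {Meets n}
      ... | no none = contradiction (p , Ap , Pp) none
      ... | yes (q , Aq , Pq) with em {q ≈ p}
      ...   | yes q≈p = q≈p
      ...   | no q≉p =
        let r , cr , ub = proj₂ (proj₂ piece) n qp (λ { Fin.zero → Pq ; (Fin.suc _) → Pp })
        in ⊥-elim (anti q p Aq Ap q≉p (r , cr , ub Fin.zero , ub (Fin.suc Fin.zero)))
        where
        qp : Fin 2 → ℕ → FinFun H
        qp Fin.zero    = q
        qp (Fin.suc _) = p

  -- Complexity of the conditions, the order and incompatibility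

  𝕏² : Space
  𝕏² = 𝕏 H ×ˢ 𝕏 H

  -- f 0 is m*, and f (suc j) the index m with j ∈ V m.
  record Code (pf : (ℕ → FinFun H) × (ℕ → ℕ)) : Set where
    p = proj₁ pf
    f = proj₂ pf
    field
      disjoint : ∀ ((k , l) : ℕ × ℕ) → k ≢ l → Disjoint (dom H (p k)) (dom H (p l))
      above    : ∀ j → f 0 ≤ f (suc j)
      few      : ∀ ((m , L) : ℕ × List ℕ) → Unique L → All (λ j → f (suc j) ≡ m) L →
                 length L ≤ n¹ m * 2 ^ f 0
      large    : ∀ j → n⁰ (f (suc j)) ≤ length (dom H (p (suc j))) * 2 ^ f 0

  -- Each field is a conjunction of requirements on finitely many coordinates. For this reason `few`
  -- speaks of finite lists instead of the whole set of indices of level `m`.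
  Code-closed : Closed (𝕏 H ×ˢ Baire) Code
  Code-closed x lim = record
    { disjoint = ⋂-closed {S = 𝕏 H ×ˢ Baire}
        {R = λ (k , l) (p , _) → k ≢ l → Disjoint (dom H (p k)) (dom H (p l))}
        (λ (k , l) x → suc (k ⊔ l) , λ (p≗ , _) R k≢l →
          subst (λ f → Disjoint f _) (cong (dom H) (sym (p≗ k (s≤s (m≤m⊔n k l)))))
            (subst (Disjoint _) (cong (dom H) (sym (p≗ l (s≤s (m≤n⊔m k l))))) (R k≢l)))
        x (lim′ Code.disjoint)
    ; above    = ⋂-closed {S = 𝕏 H ×ˢ Baire} {R = λ j (_ , f) → f 0 ≤ f (suc j)}
        (λ j (_ , f) → suc (suc j) , λ (_ , f≗) R →
          subst (_≤ f (suc j)) (sym (f≗ 0 (s≤s z≤n))) (subst (_ ≤_) (sym (f≗ (suc j) ≤-refl)) R))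
        x (lim′ Code.above)
    ; few      = ⋂-closed {S = 𝕏 H ×ˢ Baire}
        {R = λ (m , L) (_ , f) → Unique L → All (λ j → f (suc j) ≡ m) L → length L ≤ n¹ m * 2 ^ f 0}
        (λ (m , L) _ → suc (suc (max 0 L)) , λ (_ , f≗) R L! Lm →
          subst (λ a → length L ≤ n¹ m * 2 ^ a) (sym (f≗ 0 (s≤s z≤n)))
            (R L! (All.tabulate λ j∈ → trans
              (sym (f≗ _ (s≤s (s≤s (All.lookup (xs≤max 0 L) j∈))))) (All.lookup Lm j∈))))
        x (lim′ Code.few)
    ; large    = ⋂-closed {S = 𝕏 H ×ˢ Baire}
        {R = λ j (p , f) → n⁰ (f (suc j)) ≤ length (dom H (p (suc j))) * 2 ^ f 0}
        (λ j _ → suc (suc j) , λ (p≗ , f≗) R → large-resp (p≗ (suc j) ≤-refl) (f≗ (suc j) ≤-refl) (f≗ 0 (s≤s z≤n)) R)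
        x (lim′ Code.large)
    }
    where
    lim′ : ∀ {R : Space.Carrier (𝕏 H ×ˢ Baire) → Set} → (∀ {y} → Code y → R y) →
      ∀ n → ∃ λ y → R y × Space.Agree (𝕏 H ×ˢ Baire) n x y
    lim′ field′ n = let y , Cy , ag = lim n in y , field′ Cy , ag

    large-resp : ∀ {σ σ′ : FinFun H} {a a′ b b′} → σ ≡ σ′ → a ≡ a′ → b ≡ b′ →
      n⁰ a′ ≤ length (dom H σ′) * 2 ^ b′ → n⁰ a ≤ length (dom H σ) * 2 ^ b
    large-resp refl refl refl le = le

  cond-Σ¹₁ : Σ¹₁ (𝕏 H) Cond
  cond-Σ¹₁ = Code , Code-closed , λ p → mk⇔ (encode p) (λ (f , c) → decode c)
    where
    encode : ∀ p → Cond p → ∃ λ f → Code (p , f)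
    encode p (dis , m* , V , wit) = f , record
      { disjoint = λ (k , l) → dis k l
      ; above    = λ j → proj₁ (proj₂ (W.cover j))
      ; few      = few
      ; large    = λ j → W.large _ j (proj₁ (proj₂ (W.cover j))) (proj₂ (proj₂ (W.cover j)))
      }
      where
      module W = IsWitness wit

      f : ℕ → ℕ
      f zero    = m*
      f (suc j) = proj₁ (W.cover j)

      few : ∀ ((m , L) : ℕ × List ℕ) → Unique L → All (λ j → f (suc j) ≡ m) L →
        length L ≤ n¹ m * 2 ^ m*
      few (m , [])        _  _                   = z≤n
      few (m , L@(j ∷ _)) L! Lm@(refl ∷ _) = ≤-trans
        (length-mono-⊆ L! λ i∈ → subst (λ m → _ ∈ V m) (All.lookup Lm i∈) (proj₂ (proj₂ (W.cover _))))
        (W.few m (proj₁ (proj₂ (W.cover j))))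

    decode : ∀ {p f} → Code (p , f) → Cond p
    decode {p} {f} c = (λ k l → K.disjoint (k , l)) , f 0 ,
      -- The bound on all duplicate-free lists makes the set of indices of level `m` finite, so that
      -- it can be listed.
      witness (f ∘ suc) K.above
        (λ m → enumerate (λ j → f (suc j) ≡ m) _ λ L → K.few (m , L)) K.large
      where module K = Code c

  𝕏²-antitone : Antitone 𝕏²
  𝕏²-antitone = ×-antitone {𝕏 H} {𝕏 H} Seq-antitone Seq-antitone

  both-Σ¹₁ : ∀ {R : ℕ → ℕ → Pred (Space.Carrier 𝕏²) 0ℓ} → (∀ m k x → LocalAt {𝕏²} (R m k) x) →
    Σ¹₁ 𝕏² (λ (p , q) → (Cond p × Cond q) × (∀ m → ∃ λ k → R m k (p , q)))
  both-Σ¹₁ local = Σ¹₁-∩ {𝕏²} refl² 𝕏²-antitone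
    (Σ¹₁-∩ {𝕏²} refl² 𝕏²-antitone
      (Σ¹₁-pullback {𝕏 H} {𝕏²} proj₁ proj₁ cond-Σ¹₁)
      (Σ¹₁-pullback {𝕏 H} {𝕏²} proj₂ proj₂ cond-Σ¹₁))
    (Σ¹₁-∀∃ {𝕏²} 𝕏²-antitone local)
    where
    refl² : ∀ n x → Space.Agree 𝕏² n x x
    refl² n x = (λ _ _ → refl) , (λ _ _ → refl)

  -- The requirements defining `POS` as one sequence, the one at `m` concerning only the entry
  -- `p m`.
  Clause : (ℕ → FinFun H) → ℕ → (∀ i → H i) → Set
  Clause p zero    η = p 0 ⊑′ η
  Clause p (suc j) η = ¬ p (suc j) ⊑′ η

  Clause-resp : ∀ {p q} m {η} → p m ≡ q m → Clause p m η → Clause q m η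
  Clause-resp zero    e c = subst (_⊑′ _) e c
  Clause-resp (suc m) e c = c ∘ subst (_⊑′ _) (sym e)

  POS⇒Clause : ∀ {p η} m → POS H p η → Clause p m η
  POS⇒Clause zero    = proj₁
  POS⇒Clause (suc m) (_ , avoids) = avoids m

  Clause-local : ∀ p m {η η′} → (∀ {i} → i ∈ dom H (p m) → η i ≡ η′ i) → Clause p m η → Clause p m η′
  Clause-local p zero    η≗ c = All.tabulate λ a∈ →
    trans (sym (η≗ (∈dom⁺ (p 0) a∈))) (All.lookup c a∈)
  Clause-local p (suc m) η≗ c σ⊑ = c (All.tabulate λ a∈ →
    trans (η≗ (∈dom⁺ (p (suc m)) a∈)) (All.lookup σ⊑ a∈))

  Approx-resp : ∀ {p q J η} → (∀ i → i < suc J → p i ≡ q i) → Approx J p η → Approx J q η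
  Approx-resp p≗q (w⊑ , avoids) =
    subst (_⊑′ _) (p≗q 0 (s≤s z≤n)) w⊑ ,
    λ k k<J σ⊑ → avoids k k<J (subst (_⊑′ _) (sym (p≗q (suc k) (s≤s k<J))) σ⊑)

  -- If `p ≼ q`, each clause of `p` follows from finitely many requirements of `q`: an η satisfying
  -- enough of them can be changed outside `dom H (p m)` into an element of `POS H q`.
  order-Σ¹₁ : Σ¹₁ 𝕏² λ (p , q) → Cond p × Cond q × p ≼ q
  order-Σ¹₁ = Σ¹₁-⇔ {𝕏²} (λ (p , q) → mk⇔ (to p q) (from p q)) (both-Σ¹₁ {R} local)
    where
    R : ℕ → ℕ → Pred (Space.Carrier 𝕏²) 0ℓ
    R m J (p , q) = ∀ η → Approx J q η → Clause p m η

    local : ∀ m J x → LocalAt {𝕏²} (R m J) x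
    local m J x = suc (m ⊔ J) , λ (p≗ , q≗) Ry η aq → Clause-resp m (sym (p≗ m (s≤s (m≤m⊔n m J))))
      (Ry η (Approx-resp (λ i i≤J → q≗ i (≤-trans i≤J (s≤s (m≤n⊔m m J)))) aq))

    to : ∀ p q → (Cond p × Cond q) × (∀ m → ∃ λ J → R m J (p , q)) → Cond p × Cond q × p ≼ q
    to p q ((cp , cq) , r) = cp , cq , λ {η} η∈ →
      clause 0 η∈ , λ j → clause (suc j) η∈
      where
      clause : ∀ m {η} → POS H q η → Clause p m η
      clause m η∈ = let J , rJ = r m in rJ _ (POS⇒Approx q J η∈)

    from : ∀ p q → Cond p × Cond q × p ≼ q → (Cond p × Cond q) × (∀ m → ∃ λ J → R m J (p , q))
    from p q (cp , cq , p≼q) = (cp , cq) , λ m →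
      let J , approx = approximable cq (dom H (p m)) in J , λ η aq →
      let η′ , η′∈ , η′≗ = approx η aq in
      Clause-local p m η′≗ (POS⇒Clause m (p≼q η′∈))

  -- By `compatible`, incompatibility shows at a finite stage: for some `J` no η approximates both
  -- conditions. One quantifier over `J` suffices, so `R` is the same for all `m`.
  incompatible-Σ¹₁ : Σ¹₁ 𝕏² λ (p , q) → Cond p × Cond q × ¬ Compatible p q
  incompatible-Σ¹₁ = Σ¹₁-⇔ {𝕏²} (λ (p , q) → mk⇔ (to p q) (from p q)) (both-Σ¹₁ {R} local)
    where
    R : ℕ → ℕ → Pred (Space.Carrier 𝕏²) 0ℓ
    R _ J (p , q) = ¬ ∃ λ η → Approx J p η × Approx J q η

    local : ∀ m J x → LocalAt {𝕏²} (R m J) x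
    local _ J x = suc J , λ (p≗ , q≗) Ry (η , ap , aq) → Ry (η , Approx-resp p≗ ap , Approx-resp q≗ aq)

    to : ∀ p q → (Cond p × Cond q) × (∀ m → ∃ λ J → R m J (p , q)) → Cond p × Cond q × ¬ Compatible p q
    to p q ((cp , cq) , r) = cp , cq , λ comp →
      let η , η∈p , η∈q = Equivalence.to (compatible⇔ p q cp cq) comp
          J , none      = r 0
      in none (η , POS⇒Approx p J η∈p , POS⇒Approx q J η∈q)

    from : ∀ p q → Cond p × Cond q × ¬ Compatible p q → (Cond p × Cond q) × (∀ m → ∃ λ J → R m J (p , q))
    from p q (cp , cq , incomp) = (cp , cq) , λ _ →
      let J , comp = compatible cp cq in J , λ (η , ap , aq) → incomp (comp η ap aq)

  souslin : Souslin
  souslin = record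
    { cond-Σ¹₁ = cond-Σ¹₁ ; order-Σ¹₁ = order-Σ¹₁ ; incompatible-Σ¹₁ = incompatible-Σ¹₁ }

theorem4p3 : ExcludedMiddle 0ℓ →
    (n⁰ n¹ : ℕ → ℕ) → 𝐍 n⁰ n¹ →
    (H : ℕ → Set) → (∀ i → H i ↣ ℕ) → (∀ i → ∃₂ λ (a b : H i) → a ≢ b) →
    let open ForcingNotion (ℚ H n⁰ n¹) in
    σ-*-Linked ×
    (∀ p₀ p₁ → Cond p₀ → Cond p₁ →
      Compatible p₀ p₁ ⇔ (∃ λ η → POS H p₀ η × POS H p₁ η)) ×
    SouslinCCC
theorem4p3 em n⁰ n¹ nn H code two = linked , compatible⇔ , souslin , ccc
  where
  open Forcing em nn two
  open Complexity em nn code two
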